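{- Let $\mathcal V$ be a variety of finite signature such that $\mathcal V_{f.g.}$ has the ascending chain condition and the isomorphism problem for finite presentations in $\mathcal V$ is decidable. Let $(\alpha_n)_{n\ge1}$ be a sequence of ordinals $\le\omega^\omega$ such that $\cong_{\mathcal V_n}\ \le_c\ E_{\min}(\alpha_n)$ for all $n\ge1$, and let $\lambda=\sup_n\alpha_n$. Then $E_{\min}(\lambda)\ \not\le_c\ \cong_{\mathcal V_{f.g.}}$.
   Context: $W_e$ denotes the $e$-th c.e. set and $\langle\cdot,\cdot\rangle$ a computable pairing function. A variety is the class of algebras in a fixed algebraic signature satisfying a fixed c.e. set of equational laws. For $k\ge1$, $X_k=\{x_0,\dots,x_{k-1}\}$; fix a computable bijective coding of pairs of terms over $X_k$ by natural numbers, and for a set $R$ of pairs let $\langle X_k\mid R\rangle_{\mathcal V}$ be $\mathcal T(X_k)$ modulo the smallest congruence containing $R$ and all instances of the laws of $\mathcal V$. $\mathcal V_n[e]=\langle X_n\mid W_e\rangle_{\mathcal V}$ with $e\cong_{\mathcal V_n}i$ iff $\mathcal V_n[e]\cong\mathcal V_n[i]$; $\mathcal V_{f.g.}$ consists of $\mathcal V_{f.g.}[\langle k,e\rangle]=\langle X_k\mid W_e\rangle_{\mathcal V}$ ($k\ge1$) with $\langle k,e\rangle\cong_{\mathcal V_{f.g.}}\langle j,i\rangle$ iff these are isomorphic. ACC: every ascending chain of congruences of every algebra in $\mathcal V_{f.g.}$ is eventually constant. The isomorphism problem for finite presentations is decidable if there is an algorithm that, given finite $k,j$ and finite sets $R,S$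 of pairs of terms, decides whether $\langle X_k\mid R\rangle_{\mathcal V}\cong\langle X_j\mid S\rangle_{\mathcal V}$. For an ordinal $\alpha\le\omega^\omega$, fix a computable bijection $h$ from the ordinals $<\alpha$ (Cantor normal forms coded as finite tuples) onto $\mathbb N$, let $n\le_\alpha m$ iff $h^{ -1}(n)\le h^{ -1}(m)$, and $e\,E_{\min}(\alpha)\,i$ iff $W_e,W_i$ are both empty or have the same $\le_\alpha$-least element. $E\le_c F$ means there is a total computable $h$ with $x\,E\,y\iff h(x)\,F\,h(y)$. -}

module Defs where

open import Data.Nat using (ℕ; zero; suc; _+_; _*_; _∸_; _^_; _≤_; ⌊_/2⌋; pred; _≡ᵇ_; _<ᵇ_)
open import Data.Bool using (Bool; true; false; if_then_else_; T)
open import Data.List using (List; []; _∷_; reverse; map)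
open import Data.List.Membership.Propositional using (_∈_)
open import Data.Maybe using (Maybe; just; nothing)
open import Data.Fin using (Fin; toℕ)
import Data.Fin as F
open import Data.Product using (Σ; _×_; _,_; proj₁; proj₂)
open import Data.Sum using (_⊎_)
open import Data.Empty using (⊥)
open import Data.Unit using (⊤)
open import Relation.Nullary using (¬_)
open import Relation.Binary.PropositionalEquality using (_≡_)

odd : ℕ → Bool
odd zero = false
odd (suc zero) = true
odd (suc (suc n)) = odd n

pair : ℕ → ℕ → ℕ
pair a b = 2 ^ a * suc (2 * b) ∸ 1

-- split fuel n = (a , b) with n = 2^a (2b+1), for n ≥ 1 (fuel n suffices).
split : ℕ → ℕ → ℕ × ℕ
split zero n = 0 , 0
split (suc f) n =
  if odd n then (0 , ⌊ n /2⌋)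
  else (suc (proj₁ (split f ⌊ n /2⌋)) , proj₂ (split f ⌊ n /2⌋))

unpair : ℕ → ℕ × ℕ
unpair m = split (suc m) (suc m)

bitsFrom : ℕ → ℕ → ℕ → List ℕ
bitsFrom zero p n = []
bitsFrom (suc f) p zero = []
bitsFrom (suc f) p (suc n) =
  if odd (suc n) then p ∷ bitsFrom f (suc p) ⌊ suc n /2⌋
  else bitsFrom f (suc p) ⌊ suc n /2⌋

bits : ℕ → List ℕ
bits n = bitsFrom n 0 n

gaps : ℕ → List ℕ → List ℕ
gaps off [] = []
gaps off (p ∷ ps) = (p ∸ off) ∷ gaps (suc p) ps

decodeList : ℕ → List ℕ
decodeList n = gaps 0 (bits n)

encList' : ℕ → List ℕ → ℕ
encList' off [] = 0
encList' off (l ∷ ls) = 2 ^ (off + l) + encList' (suc (off + l)) ls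

encodeList : List ℕ → ℕ
encodeList = encList' 0

nthD : List ℕ → ℕ → ℕ
nthD [] _ = 0
nthD (x ∷ xs) zero = x
nthD (x ∷ xs) (suc i) = nthD xs i

nth : {A : Set} → List A → ℕ → Maybe A
nth [] _ = nothing
nth (x ∷ xs) zero = just x
nth (x ∷ xs) (suc i) = nth xs i

toFin : (n : ℕ) → ℕ → Maybe (Fin n)
toFin zero _ = nothing
toFin (suc n) zero = just F.zero
toFin (suc n) (suc a) with toFin n a
... | just i = just (F.suc i)
... | nothing = nothing

-- 2. Model of computation: register (Minsky) machines.
-- inc r : increment register r, go to next instruction.
-- dec r j : if register r is 0 jump to instruction j, else decrement it and go on.
-- A machine halts when the program counter leaves the program.

data Instr : Set where
  inc : ℕ → Instr
  dec : ℕ → ℕ → Instr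

decodeInstr : ℕ → Instr
decodeInstr m =
  if odd m then dec (proj₁ (unpair ⌊ m /2⌋)) (proj₂ (unpair ⌊ m /2⌋))
  else inc ⌊ m /2⌋

decodeProg : ℕ → List Instr
decodeProg n = map decodeInstr (decodeList n)

upd : (ℕ → ℕ) → ℕ → ℕ → (ℕ → ℕ)
upd r x v y = if y ≡ᵇ x then v else r y

run : ℕ → List Instr → ℕ → (ℕ → ℕ) → Maybe (ℕ → ℕ)
run fuel p pc r with nth p pc
... | nothing = just r
... | just i with fuel
...   | zero = nothing
...   | suc f with i
...     | inc x = run f p (suc pc) (upd r x (suc (r x)))
...     | dec x j with r x
...       | zero = run f p j r
...       | suc v = run f p (suc pc) (upd r x v)

input : ℕ → ℕ → ℕ
input x zero = x
input x (suc _) = 0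

Out : ℕ → ℕ → ℕ → Set
Out e x y = Σ ℕ λ fuel → Σ (ℕ → ℕ) λ r →
  (run fuel (decodeProg e) 0 (input x) ≡ just r) × (r 0 ≡ y)

W : ℕ → ℕ → Set
W e x = Σ ℕ λ y → Out e x y

Total : ℕ → Set
Total p = ∀ x → Σ ℕ λ y → Out p x y

_≤c_ : (ℕ → ℕ → Set) → (ℕ → ℕ → Set) → Set
E ≤c F = Σ ℕ λ p → Total p ×
  (∀ x y fx fy → Out p x fx → Out p y fy → (E x y → F fx fy) × (F fx fy → E x y))

-- 3. Ordinals ≤ ω^ω.  An ordinal < ω^ω is a Cantor normal form
-- ω^e₁ + … + ω^eₘ with e₁ ≥ … ≥ eₘ, i.e. a non-increasing list of exponents.

data NonInc : List ℕ → Set where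
  nil  : NonInc []
  one  : ∀ x → NonInc (x ∷ [])
  cons : ∀ {x y ys} → y ≤ x → NonInc (y ∷ ys) → NonInc (x ∷ y ∷ ys)

ltL : List ℕ → List ℕ → Bool
ltL [] [] = false
ltL [] (_ ∷ _) = true
ltL (_ ∷ _) [] = false
ltL (x ∷ xs) (y ∷ ys) = if x <ᵇ y then true else (if x ≡ᵇ y then ltL xs ys else false)

data OrdLe : Set where
  cnf : (β : List ℕ) → NonInc β → OrdLe
  ωω  : OrdLe

omega : OrdLe
omega = cnf (1 ∷ []) (one 1)

_≤O_ : OrdLe → OrdLe → Set
cnf β _ ≤O cnf γ _ = T (ltL β γ) ⊎ β ≡ γ
cnf _ _ ≤O ωω = ⊤
ωω ≤O cnf _ _ = ⊥
ωω ≤O ωω = ⊤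

belowB : List ℕ → OrdLe → Bool
belowB β (cnf γ _) = ltL β γ
belowB β ωω = true

-- bijective code of CNFs (< ω^ω) by naturals:
-- [e₁ ≥ … ≥ eₘ] ↦ Σᵢ 2^(aᵢ + i), where a = reverse of the list.
ordEnc' : ℕ → List ℕ → ℕ
ordEnc' i [] = 0
ordEnc' i (a ∷ as) = 2 ^ (a + i) + ordEnc' (suc i) as

ordCode : List ℕ → ℕ
ordCode β = ordEnc' 0 (reverse β)

ordDec' : ℕ → List ℕ → List ℕ
ordDec' i [] = []
ordDec' i (p ∷ ps) = (p ∸ i) ∷ ordDec' (suc i) ps

ordDecode : ℕ → List ℕ
ordDecode n = reverse (ordDec' 0 (bits n))

cnt : OrdLe → ℕ → ℕ
cnt α zero = 0
cnt α (suc N) = (if belowB (ordDecode N) α then 1 else 0) + cnt α N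

-- the fixed computable bijection h_α : {β < α} → ℕ (onto ℕ when α ≥ ω)
hα : OrdLe → List ℕ → ℕ
hα α β = cnt α (ordCode β)

_≤[_]_ : ℕ → OrdLe → ℕ → Set
n ≤[ α ] m = Σ (List ℕ) λ β → Σ (List ℕ) λ γ →
  NonInc β × NonInc γ × T (belowB β α) × T (belowB γ α) ×
  (hα α β ≡ n) × (hα α γ ≡ m) × (T (ltL β γ) ⊎ β ≡ γ)

IsLeast : OrdLe → (ℕ → Set) → ℕ → Set
IsLeast α P x = P x × (∀ y → P y → x ≤[ α ] y)

Emin : OrdLe → ℕ → ℕ → Set
Emin α e i = ((∀ x → ¬ W e x) × (∀ x → ¬ W i x))
           ⊎ (Σ ℕ λ x → IsLeast α (W e) x × IsLeast α (W i) x)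

IsSup : (ℕ → OrdLe) → OrdLe → Set
IsSup α l = (∀ n → α (suc n) ≤O l) × (∀ μ → (∀ n → α (suc n) ≤O μ) → l ≤O μ)

record Sig : Set where
  field
    nsym  : ℕ
    arity : Fin nsym → ℕ

data Term (σ : Sig) (V : Set) : Set where
  var : V → Term σ V
  op  : (f : Fin (Sig.nsym σ)) → (Fin (Sig.arity σ f) → Term σ V) → Term σ V

-- a variety: finite signature + c.e. index of its set of laws
-- (equations between terms in the variables x₀, x₁, … coded as in decPair)
record Variety : Set where
  field
    sig    : Sig
    lawIdx : ℕ

module _ (σ : Sig) where
  open Sig σ

  sub : {V X : Set} → (V → Term σ X) → Term σ V → Term σ X
  sub s (var x) = s x
  sub s (op f ts) = op f (λ i → sub s (ts i))

  -- computable (surjective) decoding of terms; v decodes variable indices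
  decTermF : {V : Set} → (ℕ → V) → ℕ → ℕ → Term σ V
  decTermF v zero n = var (v 0)
  decTermF {V} v (suc fu) n = build (proj₁ (unpair n)) (proj₂ (unpair n))
    where
    buildOp : Maybe (Fin nsym) → ℕ → Term σ V
    buildOp nothing b = var (v b)
    buildOp (just g) b = op g (λ i → decTermF v fu (nthD (decodeList b) (toℕ i)))
    build : ℕ → ℕ → Term σ V
    build zero b = var (v b)
    build (suc a) b = buildOp (toFin nsym a) b

  decTerm : {V : Set} → (ℕ → V) → ℕ → Term σ V
  decTerm v n = decTermF v (suc n) n

  decPair : {V : Set} → (ℕ → V) → ℕ → Term σ V × Term σ V
  decPair v m = decTerm v (proj₁ (unpair m)) , decTerm v (proj₂ (unpair m))

-- variable decoding for X_{k+1} = {x₀,…,x_k}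
varK : (k : ℕ) → ℕ → Fin (suc k)
varK k b with toFin (suc k) b
... | just i = i
... | nothing = F.zero

module _ (𝒱 : Variety) where
  open Variety 𝒱
  open Sig sig

  TermV : Set → Set
  TermV V = Term sig V

  data Gen {n : ℕ} (R : TermV (Fin n) → TermV (Fin n) → Set)
       : TermV (Fin n) → TermV (Fin n) → Set where
    base : ∀ {t u} → R t u → Gen R t u
    law  : ∀ m → W lawIdx m → (s : ℕ → TermV (Fin n)) →
           Gen R (sub sig s (proj₁ (decPair sig (λ x → x) m)))
                 (sub sig s (proj₂ (decPair sig (λ x → x) m)))
    rfl  : ∀ t → Gen R t t
    sym′ : ∀ {t u} → Gen R t u → Gen R u t
    trn  : ∀ {t u w} → Gen R t u → Gen R u w → Gen R t w
    cng  : ∀ f (ts us : Fin (arity f) → TermV (Fin n)) →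
           (∀ i → Gen R (ts i) (us i)) → Gen R (op f ts) (op f us)

  RelW : (k e : ℕ) → TermV (Fin (suc k)) → TermV (Fin (suc k)) → Set
  RelW k e t u = Σ ℕ λ m → W e m × (decPair sig (varK k) m ≡ (t , u))

  RelL : (k : ℕ) → List ℕ → TermV (Fin (suc k)) → TermV (Fin (suc k)) → Set
  RelL k R t u = Σ ℕ λ m → (m ∈ R) × (decPair sig (varK k) m ≡ (t , u))

  Hom : ∀ {n p} → (TermV (Fin n) → TermV (Fin p)) →
        (TermV (Fin p) → TermV (Fin p) → Set) → Set
  Hom f B = ∀ g ts → B (f (op g ts)) (op g (λ i → f (ts i)))

  Resp : ∀ {n p} → (TermV (Fin n) → TermV (Fin p)) →
         (TermV (Fin n) → TermV (Fin n) → Set) →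
         (TermV (Fin p) → TermV (Fin p) → Set) → Set
  Resp f A B = ∀ t u → A t u → B (f t) (f u)

  IsoQ : ∀ {n p} → (TermV (Fin n) → TermV (Fin n) → Set) →
         (TermV (Fin p) → TermV (Fin p) → Set) → Set
  IsoQ {n} {p} A B =
    Σ (TermV (Fin n) → TermV (Fin p)) λ f →
    Σ (TermV (Fin p) → TermV (Fin n)) λ g →
    Resp f A B × Resp g B A × Hom f B × Hom g A ×
    (∀ t → A (g (f t)) t) × (∀ u → B (f (g u)) u)

  -- ≅_{𝒱_n} (n ≥ 1; the value at n = 0 is irrelevant and set to n = 1)
  VnIso : ℕ → ℕ → ℕ → Set
  VnIso n e i = IsoQ (Gen (RelW (pred n) e)) (Gen (RelW (pred n) i))

  -- ≅_{𝒱_f.g.}: index ⟨k,e⟩ ↦ ⟨X_k | W_e⟩ (k = 0 read as k = 1)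
  VfgIso : ℕ → ℕ → Set
  VfgIso x y =
    IsoQ (Gen (RelW (pred (proj₁ (unpair x))) (proj₂ (unpair x))))
         (Gen (RelW (pred (proj₁ (unpair y))) (proj₂ (unpair y))))

  -- θ is a congruence of the quotient algebra ⟨X_{k+1} | W_e⟩ (as a congruence on terms above Gen)
  CongAbove : ∀ {n} → (TermV (Fin n) → TermV (Fin n) → Set) →
              (TermV (Fin n) → TermV (Fin n) → Set) → Set
  CongAbove {n} G θ =
    (∀ t u → G t u → θ t u) ×
    (∀ t → θ t t) × (∀ t u → θ t u → θ u t) × (∀ t u w → θ t u → θ u w → θ t w) ×
    (∀ f (ts us : Fin (arity f) → TermV (Fin n)) → (∀ i → θ (ts i) (us i)) → θ (op f ts) (op f us))

  ACC : Set₁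
  ACC = ∀ (k e : ℕ) (θ : ℕ → TermV (Fin (suc k)) → TermV (Fin (suc k)) → Set) →
        (∀ i → CongAbove (Gen (RelW k e)) (θ i)) →
        (∀ i t u → θ i t u → θ (suc i) t u) →
        ¬ ¬ (Σ ℕ λ N → ∀ m → N ≤ m → ∀ t u → θ m t u → θ N t u)

  DecFP : Set
  DecFP = Σ ℕ λ d → ∀ (k j : ℕ) (R S : List ℕ) →
    (Out d (pair k (pair j (pair (encodeList R) (encodeList S)))) 0 ×
       IsoQ (Gen (RelL k R)) (Gen (RelL j S)))
    ⊎ (Out d (pair k (pair j (pair (encodeList R) (encodeList S)))) 1 ×
       ¬ IsoQ (Gen (RelL k R)) (Gen (RelL j S)))

{-# OPTIONS --safe #-}
module Submission where

-- Say that an index e has level β < λ if hλ β is the least element of W_e, and level ⊤ if W_e is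
-- empty. Suppose that p reduces Emin λ to isomorphism of finitely generated algebras, and let A_ℓ be
-- the algebra assigned to the level ℓ. If γ < ℓ, then A_γ is a proper quotient of A_ℓ: by the
-- recursion theorem take an e that has level ℓ until the decision procedure recognises a finite part
-- of the presentation p(e) as a presentation of A_ℓ, and that then moves to level γ. (By the chain
-- condition congruences are finitely generated, so this does happen.) In the same way, on n
-- generators the reduction to Emin α_n gives every congruence a level, and a larger congruence with a
-- non-isomorphic quotient has a smaller level.
-- Present A_⊤, which has k generators, on k + 1 generators. It is not free there, because finitely
-- generated free algebras are Hopfian by the chain condition (unless 𝒱 is trivial, when Emin λ would
-- have a single class); so its level in α_{k+1} is some γ < ⊤. Now A_γ is a proper quotient of A_⊤,
-- hence has a level δ < γ, so A_δ is a proper quotient of A_γ, and so on: an infinite descent.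
-- Constructively everything happens under a double negation, as the conclusion is negative; Emin α
-- is reflexive on the values of a reduction, so that the levels themselves exist outright.

open import Defs
open import Data.Nat
open import Data.Nat.Properties
open import Data.Nat.Tactic.RingSolver using (solve-∀)
open import Data.Bool using (true; false; if_then_else_; T)
open import Data.Fin using (Fin; toℕ)
import Data.Fin as F
open import Data.List using (List; []; _∷_; reverse; map; _++_; length; replicate; _ʳ++_)
open import Data.List.Properties using (reverse-involutive; length-++; length-replicate; map-++)
open import Data.List.Membership.Propositional using (_∈_)
open import Data.List.Relation.Unary.Any using (here; there)
open import Data.Maybe using (Maybe; just; nothing)
open import Data.Vec as V using (Vec; []; _∷_)
open import Data.Product using (Σ; _×_; _,_; proj₁; proj₂; ∃)
open import Data.Sum using (_⊎_; inj₁; inj₂)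
open import Data.Empty using (⊥; ⊥-elim)
open import Data.Unit using (⊤; tt)
open import Induction.WellFounded using (Acc; acc)
open import Relation.Nullary using (¬_; Dec; yes; no)
open import Relation.Binary.Definitions using (tri<; tri≈; tri>)
open import Relation.Binary.PropositionalEquality
open import Function using (_∘_; id)

-- Codes of pairs and lists

odd-2* : ∀ b → odd (2 * b) ≡ false
odd-2* zero = refl
odd-2* (suc b) rewrite +-suc b (b + 0) = odd-2* b

odd-1+2* : ∀ b → odd (suc (2 * b)) ≡ true
odd-1+2* zero = refl
odd-1+2* (suc b) rewrite +-suc b (b + 0) = odd-1+2* b

half-2* : ∀ b → ⌊ 2 * b /2⌋ ≡ b
half-2* zero = refl
half-2* (suc b) rewrite +-suc b (b + 0) = cong suc (half-2* b)

half-1+2* : ∀ b → ⌊ suc (2 * b) /2⌋ ≡ b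
half-1+2* zero = refl
half-1+2* (suc b) rewrite +-suc b (b + 0) = cong suc (half-1+2* b)

n<2^n : ∀ n → n < 2 ^ n
n<2^n zero = z<s
n<2^n (suc n) = begin-strict
  suc n       ≤⟨ n<2^n n ⟩
  2 ^ n       <⟨ m<m+n (2 ^ n) (≤-trans (m^n>0 2 n) (m≤m+n (2 ^ n) 0)) ⟩
  2 ^ suc n   ∎
  where open ≤-Reasoning

2^[1+a]*m : ∀ a m → 2 ^ suc a * m ≡ 2 * (2 ^ a * m)
2^[1+a]*m a m = *-assoc 2 (2 ^ a) m

split-2^*odd : ∀ f a b → a ≤ f → split (suc f) (2 ^ a * suc (2 * b)) ≡ (a , b)
split-2^*odd f zero b _ rewrite +-identityʳ (suc (2 * b)) | odd-1+2* b | half-1+2* b = refl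
split-2^*odd (suc f) (suc a) b (s≤s a≤f)
  rewrite 2^[1+a]*m a (suc (2 * b)) | odd-2* (2 ^ a * suc (2 * b)) | half-2* (2 ^ a * suc (2 * b))
        | split-2^*odd f a b a≤f = refl

-- The list with head x and code n for its tail.
infixr 5 _∷ᶜ_
_∷ᶜ_ : ℕ → ℕ → ℕ
x ∷ᶜ n = suc (pair x n)

∷ᶜ≡ : ∀ a b → a ∷ᶜ b ≡ 2 ^ a * suc (2 * b)
∷ᶜ≡ a b = m+[n∸m]≡n (*-mono-≤ (m^n>0 2 a) (s≤s (z≤n {2 * b})))

m<2^m*odd : ∀ a b → a < 2 ^ a * suc (2 * b)
m<2^m*odd a b = ≤-trans (n<2^n a) (m≤m*n (2 ^ a) (suc (2 * b)))

unpair-pair : ∀ a b → unpair (pair a b) ≡ (a , b)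
unpair-pair a b = begin
  split (a ∷ᶜ b) (a ∷ᶜ b)         ≡⟨ cong (split (a ∷ᶜ b)) (∷ᶜ≡ a b) ⟩
  split (a ∷ᶜ b) (2 ^ a * suc (2 * b))
    ≡⟨ split-2^*odd (pair a b) a b (≤-pred (subst (a <_) (sym (∷ᶜ≡ a b)) (m<2^m*odd a b))) ⟩
  (a , b)                          ∎
  where open ≡-Reasoning

opaque
  fst snd : ℕ → ℕ
  fst n = proj₁ (unpair n)
  snd n = proj₂ (unpair n)

  fst≡ : ∀ n → fst n ≡ proj₁ (unpair n)
  fst≡ n = refl

  snd≡ : ∀ n → snd n ≡ proj₂ (unpair n)
  snd≡ n = refl

fst-pair : ∀ a b → fst (pair a b) ≡ a
fst-pair a b = trans (fst≡ (pair a b)) (cong proj₁ (unpair-pair a b))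

snd-pair : ∀ a b → snd (pair a b) ≡ b
snd-pair a b = trans (snd≡ (pair a b)) (cong proj₂ (unpair-pair a b))

a<∷ᶜ : ∀ a b → a < a ∷ᶜ b
a<∷ᶜ a b = subst (a <_) (sym (∷ᶜ≡ a b)) (m<2^m*odd a b)

b<∷ᶜ : ∀ a b → b < a ∷ᶜ b
b<∷ᶜ a b = subst (b <_) (sym (∷ᶜ≡ a b)) (≤-trans (s≤s (m≤m+n b (b + 0))) (m≤n*m (suc (2 * b)) (2 ^ a) {{m^n≢0 2 a}}))

snd≤ : ∀ a b → b ≤ pair a b
snd≤ a b = ≤-pred (b<∷ᶜ a b)

half≤ : ∀ {n f} → suc n ≤ suc f → ⌊ suc n /2⌋ ≤ f
half≤ {n} (s≤s p) = ≤-trans (≤-pred (⌊n/2⌋<n n)) p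

-- decodeList reads the gaps between consecutive one bits; g counts the zeros seen so far.
decFrom : ℕ → ℕ → ℕ → List ℕ
decFrom zero g n = []
decFrom (suc f) g zero = []
decFrom (suc f) g (suc n) =
  if odd (suc n) then g ∷ decFrom f 0 ⌊ suc n /2⌋
  else decFrom f (suc g) ⌊ suc n /2⌋

-- `off` is the position just after the last one bit, so that after `g` zeros the bit to be read is
-- at `off + g`.
gaps-bitsFrom : ∀ f off g n → gaps off (bitsFrom f (off + g) n) ≡ decFrom f g n
gaps-bitsFrom zero off g n = refl
gaps-bitsFrom (suc f) off g zero = refl
gaps-bitsFrom (suc f) off g (suc n) with odd (suc n)
... | true = cong₂ _∷_ (m+n∸m≡n off g)
               (trans (cong (λ z → gaps (suc (off + g)) (bitsFrom f z ⌊ suc n /2⌋)) (sym (+-identityʳ (suc (off + g)))))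
                      (gaps-bitsFrom f (suc (off + g)) 0 ⌊ suc n /2⌋))
... | false rewrite sym (+-suc off g) = gaps-bitsFrom f off (suc g) ⌊ suc n /2⌋

decFrom-fuel : ∀ f f′ g n → n ≤ f → n ≤ f′ → decFrom f g n ≡ decFrom f′ g n
decFrom-fuel zero zero g zero p q = refl
decFrom-fuel zero (suc f′) g zero p q = refl
decFrom-fuel (suc f) zero g zero p q = refl
decFrom-fuel (suc f) (suc f′) g zero p q = refl
decFrom-fuel (suc f) (suc f′) g (suc n) p q with odd (suc n)
... | true = cong (g ∷_) (decFrom-fuel f f′ 0 ⌊ suc n /2⌋ (half≤ p) (half≤ q))
... | false = decFrom-fuel f f′ (suc g) ⌊ suc n /2⌋ (half≤ p) (half≤ q)

even-half≥1 : ∀ n → odd (suc n) ≡ false → 1 ≤ ⌊ suc n /2⌋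
even-half≥1 (suc n) e = s≤s z≤n

-- In n = 2^a (2b + 1) the lowest one bit is at position a, and the bits above it are those of b.
-- Hence the list code is an iterated pairing.
decFrom-split : ∀ f g n → 1 ≤ n → n ≤ f →
  decFrom f g n ≡ (g + proj₁ (split f n)) ∷ decodeList (proj₂ (split f n))
decFrom-split (suc f) g (suc n) _ p with odd (suc n) in eq
... | true = cong₂ _∷_ (sym (+-identityʳ g))
      (trans (decFrom-fuel f ⌊ suc n /2⌋ 0 _ (half≤ p) ≤-refl) (sym (gaps-bitsFrom ⌊ suc n /2⌋ 0 0 ⌊ suc n /2⌋)))
... | false = trans (decFrom-split f (suc g) ⌊ suc n /2⌋ (even-half≥1 n eq) (half≤ p))
      (cong (_∷ decodeList (proj₂ (split f ⌊ suc n /2⌋))) (sym (+-suc g _)))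

decodeList-suc : ∀ m → decodeList (suc m) ≡ fst m ∷ decodeList (snd m)
decodeList-suc m = trans (gaps-bitsFrom (suc m) 0 0 (suc m)) (trans (decFrom-split (suc m) 0 (suc m) (s≤s z≤n) ≤-refl)
  (sym (cong₂ (λ a b → a ∷ decodeList b) (fst≡ m) (snd≡ m))))

decodeList-∷ᶜ : ∀ x n → decodeList (x ∷ᶜ n) ≡ x ∷ decodeList n
decodeList-∷ᶜ x n = trans (decodeList-suc (pair x n)) (cong₂ (λ a b → a ∷ decodeList b) (fst-pair x n) (snd-pair x n))

encList'-shift : ∀ off l → encList' off l ≡ 2 ^ off * encList' 0 l
encList'-shift off [] = sym (*-zeroʳ (2 ^ off))
encList'-shift off (x ∷ l) = begin
  2 ^ (off + x) + encList' (suc (off + x)) l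
    ≡⟨ cong₂ _+_ (^-distribˡ-+-* 2 off x) (trans (encList'-shift (suc (off + x)) l)
         (cong (λ z → 2 * z * encList' 0 l) (^-distribˡ-+-* 2 off x))) ⟩
  2 ^ off * 2 ^ x + 2 * (2 ^ off * 2 ^ x) * encList' 0 l
    ≡⟨ lem (2 ^ off) (2 ^ x) (encList' 0 l) ⟩
  2 ^ off * (2 ^ x + 2 ^ suc x * encList' 0 l)
    ≡⟨ cong (λ z → 2 ^ off * (2 ^ x + z)) (encList'-shift (suc x) l) ⟨
  2 ^ off * encList' 0 (x ∷ l) ∎
  where
  open ≡-Reasoning
  lem : ∀ a b c → a * b + 2 * (a * b) * c ≡ a * (b + 2 * b * c)
  lem = solve-∀

encodeList-∷ : ∀ x l → encodeList (x ∷ l) ≡ x ∷ᶜ encodeList l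
encodeList-∷ x l = begin
  2 ^ x + encList' (suc x) l             ≡⟨ cong (2 ^ x +_) (encList'-shift (suc x) l) ⟩
  2 ^ x + 2 * 2 ^ x * encodeList l       ≡⟨ lem (2 ^ x) (encodeList l) ⟩
  2 ^ x * suc (2 * encodeList l)         ≡⟨ ∷ᶜ≡ x (encodeList l) ⟨
  x ∷ᶜ encodeList l                      ∎
  where
  open ≡-Reasoning
  lem : ∀ a c → a + 2 * a * c ≡ a * suc (2 * c)
  lem = solve-∀

decode-encode : ∀ l → decodeList (encodeList l) ≡ l
decode-encode [] = refl
decode-encode (x ∷ l) = begin
  decodeList (encodeList (x ∷ l)) ≡⟨ cong decodeList (encodeList-∷ x l) ⟩
  decodeList (x ∷ᶜ encodeList l)  ≡⟨ decodeList-∷ᶜ x (encodeList l) ⟩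
  x ∷ decodeList (encodeList l)   ≡⟨ cong (x ∷_) (decode-encode l) ⟩
  x ∷ l                           ∎
  where open ≡-Reasoning


-- Codes of ordinals

data Incr : ℕ → List ℕ → Set where
  []  : ∀ {o} → Incr o []
  _∷_ : ∀ {o p ps} → o ≤ p → Incr (suc p) ps → Incr o (p ∷ ps)

Incr-≤ : ∀ {o o′ ps} → o ≤ o′ → Incr o′ ps → Incr o ps
Incr-≤ p [] = []
Incr-≤ p (q ∷ r) = ≤-trans p q ∷ r

bitsFrom-Incr : ∀ f p n → Incr p (bitsFrom f p n)
bitsFrom-Incr zero p n = []
bitsFrom-Incr (suc f) p zero = []
bitsFrom-Incr (suc f) p (suc n) with odd (suc n)
... | true = ≤-refl ∷ bitsFrom-Incr f (suc p) ⌊ suc n /2⌋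
... | false = Incr-≤ (n≤1+n p) (bitsFrom-Incr f (suc p) ⌊ suc n /2⌋)

ungap : ℕ → List ℕ → List ℕ
ungap off [] = []
ungap off (g ∷ gs) = (off + g) ∷ ungap (suc (off + g)) gs

-- Strict increase makes every truncated subtraction in `gaps` exact.
ungap-gaps : ∀ {o ps} → Incr o ps → ungap o (gaps o ps) ≡ ps
ungap-gaps [] = refl
ungap-gaps {o} {p ∷ ps} (o≤p ∷ i) rewrite m+[n∸m]≡n o≤p = cong (p ∷_) (ungap-gaps i)

bits-ungap : ∀ n → bits n ≡ ungap 0 (decodeList n)
bits-ungap n = sym (ungap-gaps (bitsFrom-Incr n 0 n))

data NonDec : ℕ → List ℕ → Set where
  []  : ∀ {o} → NonDec o []
  _∷_ : ∀ {o a as} → o ≤ a → NonDec a as → NonDec o (a ∷ as)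

diffs : ℕ → List ℕ → List ℕ
diffs p [] = []
diffs p (a ∷ as) = (a ∸ p) ∷ diffs a as

+-∸-shuffle : ∀ {p a} i → p ≤ a → p + i + (a ∸ p) ≡ a + i
+-∸-shuffle {p} {a} i p≤a = begin
  p + i + (a ∸ p)   ≡⟨ +-assoc p i _ ⟩
  p + (i + (a ∸ p)) ≡⟨ cong (p +_) (+-comm i _) ⟩
  p + ((a ∸ p) + i) ≡⟨ +-assoc p _ i ⟨
  p + (a ∸ p) + i   ≡⟨ cong (_+ i) (m+[n∸m]≡n p≤a) ⟩
  a + i             ∎
  where open ≡-Reasoning

-- The one bits of an ordinal code are at the positions a + i, where a is the i-th exponent in
-- non-decreasing order. The gaps between them are the differences of successive exponents, so an
-- ordinal code is the list code of these differences.
ordEnc'-diffs : ∀ i {p as} → NonDec p as → encList' (p + i) (diffs p as) ≡ ordEnc' i as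
ordEnc'-diffs i [] = refl
ordEnc'-diffs i {p} {a ∷ as} (p≤a ∷ d) rewrite +-∸-shuffle i p≤a | sym (+-suc a i) =
  cong (2 ^ (a + i) +_) (ordEnc'-diffs (suc i) d)

ordDec'-ungap : ∀ i {p as} → NonDec p as → ordDec' i (ungap (p + i) (diffs p as)) ≡ as
ordDec'-ungap i [] = refl
ordDec'-ungap i {p} {a ∷ as} (p≤a ∷ d) rewrite +-∸-shuffle i p≤a | sym (+-suc a i) =
  cong₂ _∷_ (m+n∸n≡m a i) (ordDec'-ungap (suc i) d)

NonInc-ʳ++ : ∀ {x xs as} → NonInc (x ∷ xs) → NonDec x as → NonDec 0 ((x ∷ xs) ʳ++ as)
NonInc-ʳ++ (one x) d = z≤n ∷ d
NonInc-ʳ++ (cons y≤x n) d = NonInc-ʳ++ n (y≤x ∷ d)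

NonDec-reverse : ∀ {β} → NonInc β → NonDec 0 (reverse β)
NonDec-reverse nil = []
NonDec-reverse n@(one _) = NonInc-ʳ++ n []
NonDec-reverse n@(cons _ _) = NonInc-ʳ++ n []

ordDecode-ordCode : ∀ {β} → NonInc β → ordDecode (ordCode β) ≡ β
ordDecode-ordCode {β} n = begin
  reverse (ordDec' 0 (bits (ordEnc' 0 as)))
    ≡⟨ cong (reverse ∘ ordDec' 0 ∘ bits) (ordEnc'-diffs 0 d) ⟨
  reverse (ordDec' 0 (bits (encodeList (diffs 0 as))))
    ≡⟨ cong (reverse ∘ ordDec' 0) (bits-ungap (encodeList (diffs 0 as))) ⟩
  reverse (ordDec' 0 (ungap 0 (decodeList (encodeList (diffs 0 as)))))
    ≡⟨ cong (reverse ∘ ordDec' 0 ∘ ungap 0) (decode-encode (diffs 0 as)) ⟩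
  reverse (ordDec' 0 (ungap 0 (diffs 0 as)))
    ≡⟨ cong reverse (ordDec'-ungap 0 d) ⟩
  reverse (reverse β)
    ≡⟨ reverse-involutive β ⟩
  β ∎
  where
  open ≡-Reasoning
  as = reverse β
  d = NonDec-reverse n

-- Primitive recursive functions

natrec : ℕ → (ℕ → ℕ → ℕ) → ℕ → ℕ
natrec a s zero = a
natrec a s (suc i) = s i (natrec a s i)

-- The index is the function itself, and a derivation shows it to be primitive recursive. In `rec`
-- the step reads the previous value first and then the round number. `ext` is needed because
-- pointwise equal functions are not identified.
mutual
  data Comp : (n : ℕ) → (Vec ℕ n → ℕ) → Set where
    var  : ∀ {n} (i : Fin n) → Comp n (λ ρ → V.lookup ρ i)
    ze   : ∀ {n} → Comp n (λ _ → 0)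
    su   : ∀ {n f} → Comp n f → Comp n (λ ρ → suc (f ρ))
    rec  : ∀ {n a s c} → Comp n a → Comp (2 + n) s → Comp n c →
           Comp n (λ ρ → natrec (a ρ) (λ i r → s (r ∷ i ∷ ρ)) (c ρ))
    call : ∀ {n k f g} → Comp k f → Comps n k g → Comp n (λ ρ → f (g ρ))
    ext  : ∀ {n f g} → (∀ ρ → f ρ ≡ g ρ) → Comp n f → Comp n g

  data Comps (n : ℕ) : (k : ℕ) → (Vec ℕ n → Vec ℕ k) → Set where
    []  : Comps n 0 (λ _ → [])
    _∷_ : ∀ {k h g} → Comp n h → Comps n k g → Comps n (suc k) (λ ρ → h ρ ∷ g ρ)

-- Loop programs

data Cmd : Set where
  skip : Cmd
  incr : ℕ → Cmd
  loop : ℕ → Cmd → Cmd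
  _⨾_  : Cmd → Cmd → Cmd

infixr 5 _⨾_

State : Set
State = ℕ → ℕ

-- Register 1 stays zero: dec 1 j serves as an unconditional jump at the end of a loop.
data Exec : Cmd → State → State → Set where
  skip  : ∀ {r} → Exec skip r r
  incr  : ∀ {x r} → Exec (incr x) r (upd r x (suc (r x)))
  seq   : ∀ {c d r r₁ r₂} → Exec c r r₁ → Exec d r₁ r₂ → Exec (c ⨾ d) r r₂
  loop0 : ∀ {x c r} → r x ≡ 0 → Exec (loop x c) r r
  loopS : ∀ {x c r v r₁ r₂} → r x ≡ suc v → Exec c (upd r x v) r₁ → r₁ 1 ≡ 0 →
          Exec (loop x c) r₁ r₂ → Exec (loop x c) r r₂

≡ᵇ-refl : ∀ x → (x ≡ᵇ x) ≡ true
≡ᵇ-refl zero = refl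
≡ᵇ-refl (suc x) = ≡ᵇ-refl x

≢⇒≡ᵇ-false : ∀ x y → x ≢ y → (x ≡ᵇ y) ≡ false
≢⇒≡ᵇ-false zero zero p = ⊥-elim (p refl)
≢⇒≡ᵇ-false zero (suc y) p = refl
≢⇒≡ᵇ-false (suc x) zero p = refl
≢⇒≡ᵇ-false (suc x) (suc y) p = ≢⇒≡ᵇ-false x y (p ∘ cong suc)

upd-same : ∀ r x v → upd r x v x ≡ v
upd-same r x v rewrite ≡ᵇ-refl x = refl

upd-other : ∀ r x v y → y ≢ x → upd r x v y ≡ r y
upd-other r x v y p rewrite ≢⇒≡ᵇ-false y x p = refl

clear : ℕ → Cmd
clear x = loop x skip

addTo : ℕ → ℕ → Cmd
addTo x y = loop x (incr y)

-- A loop destroys its counter; therefore `x` is drained into both `o` and `t`, and then restored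
-- from `t`.
copy : ℕ → ℕ → ℕ → Cmd
copy x o t = clear t ⨾ clear o ⨾ loop x (incr o ⨾ incr t) ⨾ addTo t x

Exec∃ : Cmd → State → (State → Set) → Set
Exec∃ c r Q = Σ State λ r′ → Exec c r r′ × Q r′

-- The invariant is indexed by the number of rounds left. The body starts after the decrement, hence
-- from `upd r x v`.
loop-inv : ∀ x c (I : ℕ → State → Set) →
  (∀ v r → r x ≡ suc v → I (suc v) r → Exec∃ c (upd r x v) (λ r₁ → r₁ 1 ≡ 0 × r₁ x ≡ v × I v r₁)) →
  ∀ v r → r x ≡ v → I v r → Exec∃ (loop x c) r (λ r′ → r′ x ≡ 0 × I 0 r′)
loop-inv x c I body zero r e i = r , loop0 e , e , i
loop-inv x c I body (suc v) r e i with body v r e i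
... | r₁ , ex , z , e₁ , i₁ with loop-inv x c I body v r₁ e₁ i₁
... | r₂ , ex₂ , q = r₂ , loopS e ex z ex₂ , q

clear-ok : ∀ x r → x ≢ 1 → r 1 ≡ 0 →
  Exec∃ (clear x) r (λ r′ → r′ x ≡ 0 × (∀ w → w ≢ x → r′ w ≡ r w))
clear-ok x r x≢1 z = loop-inv x skip (λ _ r′ → ∀ w → w ≢ x → r′ w ≡ r w)
  (λ v r′ e i → _ , skip , trans (upd-other r′ x v 1 (x≢1 ∘ sym)) (trans (i 1 (x≢1 ∘ sym)) z) , upd-same r′ x v ,
     λ w p → trans (upd-other r′ x v w p) (i w p))
  (r x) r refl (λ _ _ → refl)

addTo-ok : ∀ x y r → x ≢ 1 → y ≢ 1 → x ≢ y → r 1 ≡ 0 →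
  Exec∃ (addTo x y) r (λ r′ → r′ x ≡ 0 × r′ y ≡ r x + r y × (∀ w → w ≢ x → w ≢ y → r′ w ≡ r w))
addTo-ok x y r x≢1 y≢1 x≢y z
  with loop-inv x (incr y) (λ v r′ → v + r′ y ≡ r x + r y × (∀ w → w ≢ x → w ≢ y → r′ w ≡ r w))
    (λ v r′ e (s , i) →
      let a = upd r′ x v in
      _ , incr ,
      trans (upd-other a y _ 1 (y≢1 ∘ sym)) (trans (upd-other r′ x v 1 (x≢1 ∘ sym)) (trans (i 1 (x≢1 ∘ sym) (y≢1 ∘ sym)) z)) ,
      trans (upd-other a y _ x x≢y) (upd-same r′ x v) ,
      trans (cong (v +_) (trans (upd-same a y _) (cong suc (upd-other r′ x v y (x≢y ∘ sym))))) (trans (+-suc v _) s) ,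
      λ w p q → trans (upd-other a y _ w q) (trans (upd-other r′ x v w p) (i w p q)))
    (r x) r refl (refl , λ _ _ _ → refl)
... | r′ , ex , e , s , i = r′ , ex , e , s , i

infixr 4 _▷_
_▷_ : ∀ {c d r P Q} → Exec∃ c r P → (∀ r₁ → P r₁ → Exec∃ d r₁ Q) → Exec∃ (c ⨾ d) r Q
(r₁ , ex , p) ▷ k = let (r₂ , ex₂ , q) = k r₁ p in r₂ , seq ex ex₂ , q

weaken : ∀ {c r P Q} → (∀ r′ → P r′ → Q r′) → Exec∃ c r P → Exec∃ c r Q
weaken f (r′ , ex , p) = r′ , ex , f r′ p

copyLoop-ok : ∀ x o t r → x ≢ 1 → o ≢ 1 → t ≢ 1 → x ≢ o → x ≢ t → o ≢ t → r 1 ≡ 0 → r o ≡ 0 → r t ≡ 0 →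
  Exec∃ (loop x (incr o ⨾ incr t)) r (λ r′ → r′ x ≡ 0 × r′ o ≡ r x × r′ t ≡ r′ o ×
    (∀ w → w ≢ x → w ≢ o → w ≢ t → r′ w ≡ r w))
copyLoop-ok x o t r x≢1 o≢1 t≢1 x≢o x≢t o≢t z zo zt =
  loop-inv x (incr o ⨾ incr t)
    (λ v r′ → v + r′ o ≡ r x × r′ t ≡ r′ o × (∀ w → w ≢ x → w ≢ o → w ≢ t → r′ w ≡ r w))
    body (r x) r refl
    (trans (cong (r x +_) zo) (+-identityʳ _) , trans zt (sym zo) , λ _ _ _ _ → refl)
  where
  body : ∀ v r′ → r′ x ≡ suc v → _ → _
  body v r′ e (s , q , i) =
      let a = upd r′ x v
          b = upd a o (suc (a o))
          b-o = trans (upd-same a o (suc (a o))) (cong suc (upd-other r′ x v o (x≢o ∘ sym)))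
          b-t = trans (upd-other a o (suc (a o)) t (o≢t ∘ sym)) (upd-other r′ x v t (x≢t ∘ sym))
          c-o = trans (upd-other b t (suc (b t)) o o≢t) b-o
          fr = λ w p q′ q″ → trans (upd-other b t (suc (b t)) w q″) (trans (upd-other a o (suc (a o)) w q′)
                 (trans (upd-other r′ x v w p) (i w p q′ q″)))
      in
      _ , seq incr incr ,
      trans (fr 1 (x≢1 ∘ sym) (o≢1 ∘ sym) (t≢1 ∘ sym)) z ,
      trans (upd-other b t _ x x≢t) (trans (upd-other a o _ x x≢o) (upd-same r′ x v)) ,
      trans (cong (v +_) c-o) (trans (+-suc v _) s) ,
      trans (trans (upd-same b t _) (cong suc (trans b-t q))) (sym c-o) ,
      fr

copy-ok : ∀ x o t r → x ≢ 1 → o ≢ 1 → t ≢ 1 → x ≢ o → x ≢ t → o ≢ t → r 1 ≡ 0 →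
  Exec∃ (copy x o t) r (λ r′ → r′ o ≡ r x × (∀ w → w ≢ o → w ≢ t → r′ w ≡ r w))
copy-ok x o t r x≢1 o≢1 t≢1 x≢o x≢t o≢t z =
  clear-ok t r t≢1 z ▷ λ r₁ (t₁ , f₁) →
  clear-ok o r₁ o≢1 (trans (f₁ 1 (t≢1 ∘ sym)) z) ▷ λ r₂ (o₂ , f₂) →
  let z₂ = trans (f₂ 1 (o≢1 ∘ sym)) (trans (f₁ 1 (t≢1 ∘ sym)) z)
      r₂x = trans (f₂ x x≢o) (f₁ x x≢t)
  in
  copyLoop-ok x o t r₂ x≢1 o≢1 t≢1 x≢o x≢t o≢t z₂ o₂ (trans (f₂ t (o≢t ∘ sym)) t₁) ▷ λ r₃ (x₃ , s₃ , t₃ , f₃) →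
  weaken (λ r₄ (t₄ , x₄ , f₄) →
      trans (f₄ o o≢t (x≢o ∘ sym)) (trans s₃ r₂x) ,
      -- Register `x` was emptied and refilled, so it is treated apart from the registers that were
      -- never touched.
      λ w p q → frame w p q (w ≟ x) x₄ (trans (cong₂ _+_ t₃ x₃) (trans (+-identityʳ _) (trans s₃ r₂x)))
        (λ n → trans (f₄ w q n) (trans (f₃ w n p q) (trans (f₂ w p) (f₁ w q)))))
    (addTo-ok t x r₃ t≢1 x≢1 (x≢t ∘ sym) (trans (f₃ 1 (x≢1 ∘ sym) (o≢1 ∘ sym) (t≢1 ∘ sym)) z₂))
  where
  frame : ∀ {u v : State} {y} w → w ≢ o → w ≢ t → Dec (w ≡ x) → u x ≡ y → y ≡ v x → (w ≢ x → u w ≡ v w) → u w ≡ v w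
  frame w p q (yes refl) e e′ n = trans e e′
  frame w p q (no h) e e′ n = n h

regsFrom : ℕ → (k : ℕ) → Vec ℕ k
regsFrom b zero = []
regsFrom b (suc k) = b ∷ regsFrom (suc b) k

-- Register `b` counts the rounds left, `1 + b` holds the current value, `2 + b` the round number,
-- and `3 + b` the new value until it is moved to `1 + b`.
recBody : ℕ → Cmd → Cmd
recBody b S = S ⨾ clear (1 + b) ⨾ addTo (3 + b) (1 + b) ⨾ incr (2 + b)

-- In compile t ρ o b the arguments are in the registers ρ, the result goes to o,
-- and all registers from b on may be overwritten.
mutual
  compile : ∀ {n f} → Comp n f → Vec ℕ n → ℕ → ℕ → Cmd
  compile (var i) ρ o b = copy (V.lookup ρ i) o b
  compile ze ρ o b = clear o
  compile (su t) ρ o b = compile t ρ o b ⨾ incr o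
  compile (rec a s c) ρ o b =
    compile c ρ b (4 + b) ⨾ compile a ρ (1 + b) (4 + b) ⨾ clear (2 + b) ⨾
    loop b (recBody b (compile s (1 + b ∷ 2 + b ∷ ρ) (3 + b) (4 + b))) ⨾
    clear o ⨾ addTo (1 + b) o
  compile (call {k = k} t ts) ρ o b = compileArgs ts ρ b ⨾ compile t (regsFrom b k) o (b + k)
  compile (ext _ t) ρ o b = compile t ρ o b

  compileArgs : ∀ {n k g} → Comps n k g → Vec ℕ n → ℕ → Cmd
  compileArgs [] ρ b = skip
  compileArgs (t ∷ ts) ρ b = compile t ρ b (suc b) ⨾ compileArgs ts ρ (suc b)

Regs : ∀ {n} → (ℕ → Set) → Vec ℕ n → Set
Regs P ρ = ∀ i → P (V.lookup ρ i)

map-agree : ∀ {n} (r r′ : State) (ρ : Vec ℕ n) → Regs (λ w → r w ≡ r′ w) ρ → V.map r ρ ≡ V.map r′ ρ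
map-agree r r′ [] h = refl
map-agree r r′ (x ∷ ρ) h = cong₂ _∷_ (h F.zero) (map-agree r r′ ρ (h ∘ F.suc))

map-lookup : ∀ {n} (r : State) (ρ : Vec ℕ n) i → V.lookup (V.map r ρ) i ≡ r (V.lookup ρ i)
map-lookup r (x ∷ ρ) F.zero = refl
map-lookup r (x ∷ ρ) (F.suc i) = map-lookup r ρ i

regsFrom-≥ : ∀ b k → Regs (b ≤_) (regsFrom b k)
regsFrom-≥ b (suc k) F.zero = ≤-refl
regsFrom-≥ b (suc k) (F.suc i) = ≤-trans (n≤1+n b) (regsFrom-≥ (suc b) k i)

regsFrom-< : ∀ b k → Regs (_< b + k) (regsFrom b k)
regsFrom-< b (suc k) F.zero = m<m+n b z<s
regsFrom-< b (suc k) (F.suc i) = subst (V.lookup (regsFrom (suc b) k) i <_) (sym (+-suc b k)) (regsFrom-< (suc b) k i)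

shift≢ : ∀ k l {b} → k ≢ l → k + b ≢ l + b
shift≢ k l {b} p q = p (+-cancelʳ-≡ b k l q)

<-shift : ∀ k l {b} → k < l → k + b < l + b
<-shift k l {b} p = +-monoˡ-< b p

<⇒≢-shift : ∀ k {b w} → w < b → w ≢ k + b
<⇒≢-shift k {b} p = <⇒≢ (≤-trans p (m≤n+m b k))

-- Register 1 is excluded because the jumps rely on its being zero.
Good : ∀ {n} → Vec ℕ n → ℕ → Set
Good ρ b = Regs (λ w → w < b × w ≢ 1) ρ

Computes : ∀ {n} → (Vec ℕ n → ℕ) → Vec ℕ n → ℕ → ℕ → Cmd → Set
Computes f ρ o b c = ∀ r → r 1 ≡ 0 →
  Exec∃ c r (λ r′ → r′ o ≡ f (V.map r ρ) × (∀ w → w < b → w ≢ o → r′ w ≡ r w))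

lift4 : ∀ {n b} {ρ : Vec ℕ n} → Good ρ b → Good ρ (4 + b)
lift4 {b = b} g i = ≤-trans (proj₁ (g i)) (m≤n+m b 4) , proj₂ (g i)

1<4+ : ∀ {b} → 1 < 4 + b
1<4+ = s≤s (s≤s z≤n)

RecInv : ∀ {n} → (Vec ℕ (2 + n) → ℕ) → ℕ → ℕ → ℕ → (Vec ℕ n) → State → ℕ → State → Set
RecInv s A C b ρ r v q = v + q (2 + b) ≡ C ×
  q (1 + b) ≡ natrec A (λ i x → s (x ∷ i ∷ V.map r ρ)) (q (2 + b)) × (∀ w → w < b → q w ≡ r w)

recBody-ok : ∀ {n} {s : Vec ℕ (2 + n) → ℕ} {ρ : Vec ℕ n} {b S A C r} → Good ρ b → 1 < b → r 1 ≡ 0 →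
  Computes s (1 + b ∷ 2 + b ∷ ρ) (3 + b) (4 + b) S →
  ∀ v q → q b ≡ suc v → RecInv s A C b ρ r (suc v) q →
  Exec∃ (recBody b S) (upd q b v) (λ q′ → q′ 1 ≡ 0 × q′ b ≡ v × RecInv s A C b ρ r v q′)
recBody-ok {s = s} {ρ} {b} {S} {A} {C} {r} g 1<b z okS v q e (i₁ , i₂ , i₃) =
  okS (upd q b v) z₀ ▷ λ q₁ (h₁ , k₁) →
  let z₁ = trans (k₁ 1 1<4+ (<⇒≢-shift 3 1<b)) z₀ in
  clear-ok (1 + b) q₁ (<⇒≢-shift 1 1<b ∘ sym) z₁ ▷ λ q₂ (h₂ , k₂) →
  let z₂ = trans (k₂ 1 (<⇒≢-shift 1 1<b)) z₁ in
  addTo-ok (3 + b) (1 + b) q₂ (<⇒≢-shift 3 1<b ∘ sym) (<⇒≢-shift 1 1<b ∘ sym) (shift≢ 3 1 λ ()) z₂ ▷ λ q₃ (h₃ , h₃′ , k₃) →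
  let n = suc (q₃ (2 + b))
      low = λ w p → trans (upd-other q₃ (2 + b) n w (<⇒≢-shift 2 p)) (trans (k₃ w (<⇒≢-shift 3 p) (<⇒≢-shift 1 p))
              (trans (k₂ w (<⇒≢-shift 1 p)) (trans (k₁ w (≤-trans p (m≤n+m b 4)) (<⇒≢-shift 3 p))
              (trans (upd-other q b v w (<⇒≢ p)) (i₃ w p)))))
      old2 = trans (k₃ (2 + b) (shift≢ 2 3 λ ()) (shift≢ 2 1 λ ())) (trans (k₂ (2 + b) (shift≢ 2 1 λ ()))
              (trans (k₁ (2 + b) (<-shift 2 4 (s≤s (s≤s (s≤s z≤n)))) (shift≢ 2 3 λ ())) (upd-other q b v (2 + b) (shift≢ 2 0 λ ()))))
      new2 = trans (upd-same q₃ (2 + b) n) (cong suc old2)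
      new1 = trans (upd-other q₃ (2 + b) n (1 + b) (shift≢ 1 2 λ ())) (trans h₃′ (trans (cong₂ _+_ (k₂ (3 + b) (shift≢ 3 1 λ ())) h₂)
              (trans (+-identityʳ _) (trans h₁ stepEq))))
  in
  upd q₃ (2 + b) n , incr ,
  trans (low 1 1<b) z ,
  trans (upd-other q₃ (2 + b) n b (shift≢ 0 2 λ ())) (trans (k₃ b (shift≢ 0 3 λ ()) (shift≢ 0 1 λ ()))
    (trans (k₂ b (shift≢ 0 1 λ ())) (trans (k₁ b (<-shift 0 4 z<s) (shift≢ 0 3 λ ())) (upd-same q b v)))) ,
  trans (cong (v +_) new2) (trans (+-suc v _) i₁) ,
  trans new1 (cong (natrec A (λ i x → s (x ∷ i ∷ V.map r ρ))) (sym new2)) ,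
  low
  where
  z₀ : upd q b v 1 ≡ 0
  z₀ = trans (upd-other q b v 1 (<⇒≢ 1<b)) (trans (i₃ 1 1<b) z)
  envEq : V.map (upd q b v) ρ ≡ V.map r ρ
  envEq = map-agree _ _ ρ (λ i → trans (upd-other q b v _ (<⇒≢ (proj₁ (g i)))) (i₃ _ (proj₁ (g i))))
  stepEq : s (V.map (upd q b v) (1 + b ∷ 2 + b ∷ ρ)) ≡
           natrec A (λ i x → s (x ∷ i ∷ V.map r ρ)) (suc (q (2 + b)))
  stepEq = cong s (cong₂ _∷_ (trans (upd-other q b v (1 + b) (shift≢ 1 0 λ ())) i₂)
             (cong₂ _∷_ (upd-other q b v (2 + b) (shift≢ 2 0 λ ())) envEq))

rec-ok : ∀ {n} {a c : Vec ℕ n → ℕ} {s : Vec ℕ (2 + n) → ℕ} {ρ : Vec ℕ n} {o b} {TA TS TC : Cmd} →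
  Good ρ b → o < b → o ≢ 1 → 1 < b →
  Computes c ρ b (4 + b) TC → Computes a ρ (1 + b) (4 + b) TA →
  Computes s (1 + b ∷ 2 + b ∷ ρ) (3 + b) (4 + b) TS →
  Computes (λ ρ → natrec (a ρ) (λ i r → s (r ∷ i ∷ ρ)) (c ρ)) ρ o b
    (TC ⨾ TA ⨾ clear (2 + b) ⨾ loop b (recBody b TS) ⨾ clear o ⨾ addTo (1 + b) o)
rec-ok {a = a} {c} {s} {ρ} {o} {b} {TA} {TS} {TC} g o<b o≢1 1<b okC okA okS r z =
  okC r z ▷ λ r₁ (e₁ , f₁) →
  let z₁ = trans (f₁ 1 1<4+ (<⇒≢ 1<b)) z in
  okA r₁ z₁ ▷ λ r₂ (e₂ , f₂) →
  let z₂ = trans (f₂ 1 1<4+ (<⇒≢-shift 1 1<b)) z₁ in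
  clear-ok (2 + b) r₂ (<⇒≢-shift 2 1<b ∘ sym) z₂ ▷ λ r₃ (e₃ , f₃) →
  let fr = λ w p → trans (f₃ w (<⇒≢-shift 2 p)) (trans (f₂ w (≤-trans p (m≤n+m b 4)) (<⇒≢-shift 1 p))
             (f₁ w (≤-trans p (m≤n+m b 4)) (<⇒≢ p)))
      args = map-agree r r₁ ρ (λ i → sym (f₁ _ (≤-trans (proj₁ (g i)) (m≤n+m b 4)) (<⇒≢ (proj₁ (g i)))))
      b₃ = trans (f₃ b (shift≢ 0 2 λ ())) (trans (f₂ b (<-shift 0 4 z<s) (shift≢ 0 1 λ ())) e₁)
  in
  loop-inv b (recBody b TS) (RecInv s (a (V.map r ρ)) (c (V.map r ρ)) b ρ r) (recBody-ok {s = s} {ρ} g 1<b z okS)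
    (r₃ b) r₃ refl
    (trans (cong (r₃ b +_) e₃) (trans (+-identityʳ _) b₃) ,
     trans (f₃ (1 + b) (shift≢ 1 2 λ ())) (trans e₂ (trans (cong a (sym args))
       (cong (natrec (a (V.map r ρ)) (λ i x → s (x ∷ i ∷ V.map r ρ))) (sym e₃)))) ,
     fr) ▷ λ r₄ (e₄ , j₁ , j₂ , f₄) →
  let z₄ = trans (f₄ 1 1<b) z in
  clear-ok o r₄ o≢1 z₄ ▷ λ r₅ (e₅ , f₅) →
  weaken (λ r₆ (e₆ , e₆′ , f₆) →
     trans e₆′ (trans (cong₂ _+_ (f₅ (1 + b) (<⇒≢-shift 1 o<b ∘ sym)) e₅) (trans (+-identityʳ _) (trans j₂
       (cong (natrec (a (V.map r ρ)) (λ i x → s (x ∷ i ∷ V.map r ρ))) j₁)))) ,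
     λ w p q → trans (f₆ w (<⇒≢-shift 1 p) q) (trans (f₅ w q) (f₄ w p)))
   (addTo-ok (1 + b) o r₅ (<⇒≢-shift 1 1<b ∘ sym) o≢1 (<⇒≢-shift 1 o<b ∘ sym) (trans (f₅ 1 (o≢1 ∘ sym)) z₄))

mutual
  compile-ok : ∀ {n f} (t : Comp n f) (ρ : Vec ℕ n) (o b : ℕ) → Good ρ b → Regs (_≢ o) ρ →
    o < b → o ≢ 1 → 1 < b → Computes f ρ o b (compile t ρ o b)
  compile-ok (var i) ρ o b g ρ≢o o<b o≢1 1<b r z =
    weaken (λ r′ (e , f) → trans e (sym (map-lookup r ρ i)) , λ w p q → f w q (<⇒≢ p))
      (copy-ok (V.lookup ρ i) o b r (proj₂ (g i)) o≢1 (<⇒≢ 1<b ∘ sym) (ρ≢o i) (<⇒≢ (proj₁ (g i))) (<⇒≢ o<b) z)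
  compile-ok ze ρ o b g ρ≢o o<b o≢1 1<b r z =
    weaken (λ r′ (e , f) → e , λ w p q → f w q) (clear-ok o r o≢1 z)
  compile-ok (su t) ρ o b g ρ≢o o<b o≢1 1<b r z =
    compile-ok t ρ o b g ρ≢o o<b o≢1 1<b r z ▷ λ r′ (e , f) →
      _ , incr , trans (upd-same r′ o _) (cong suc e) , λ w p q → trans (upd-other r′ o _ w q) (f w p q)
  compile-ok (ext h t) ρ o b g ρ≢o o<b o≢1 1<b r z =
    weaken (λ r′ (e , fr) → trans e (h _) , fr) (compile-ok t ρ o b g ρ≢o o<b o≢1 1<b r z)
  compile-ok (call {k = k} {f = f} t ts) ρ o b g ρ≢o o<b o≢1 1<b r z =
    compileArgs-ok ts ρ b g 1<b r z ▷ λ r₁ (e₁ , f₁) →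
    weaken (λ r₂ (e₂ , f₂) → trans e₂ (cong f e₁) , λ w p q → trans (f₂ w (≤-trans p (m≤m+n b k)) q) (f₁ w p))
      (compile-ok t (regsFrom b k) o (b + k)
           (λ i → regsFrom-< b k i , (<⇒≢ (≤-trans 1<b (regsFrom-≥ b k i)) ∘ sym))
           (λ i → <⇒≢ (≤-trans o<b (regsFrom-≥ b k i)) ∘ sym) (≤-trans o<b (m≤m+n b k)) o≢1 (≤-trans 1<b (m≤m+n b k))
           r₁ (trans (f₁ 1 1<b) z))
  compile-ok (rec {a = a} {s} {c} ta ts tc) ρ o b g ρ≢o o<b o≢1 1<b =
    rec-ok {a = a} {c} {s} {ρ} g o<b o≢1 1<b
      (compile-ok tc ρ b (4 + b) (lift4 {ρ = ρ} g) (λ i → <⇒≢ (proj₁ (g i))) (<-shift 0 4 z<s) (<⇒≢ 1<b ∘ sym) 1<4+)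
      (compile-ok ta ρ (1 + b) (4 + b) (lift4 {ρ = ρ} g) (λ i → <⇒≢-shift 1 (proj₁ (g i)))
        (<-shift 1 4 (s≤s (s≤s z≤n))) (<⇒≢-shift 1 1<b ∘ sym) 1<4+)
      (compile-ok ts (1 + b ∷ 2 + b ∷ ρ) (3 + b) (4 + b)
        (λ { F.zero → <-shift 1 4 (s≤s (s≤s z≤n)) , (<⇒≢-shift 1 1<b ∘ sym)
           ; (F.suc F.zero) → <-shift 2 4 (s≤s (s≤s (s≤s z≤n))) , (<⇒≢-shift 2 1<b ∘ sym)
           ; (F.suc (F.suc i)) → lift4 {ρ = ρ} g i })
        (λ { F.zero → shift≢ 1 3 λ () ; (F.suc F.zero) → shift≢ 2 3 λ ()
           ; (F.suc (F.suc i)) → <⇒≢-shift 3 (proj₁ (g i)) })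
        (<-shift 3 4 (s≤s (s≤s (s≤s (s≤s z≤n))))) (<⇒≢-shift 3 1<b ∘ sym) 1<4+)

  compileArgs-ok : ∀ {n k g} (ts : Comps n k g) (ρ : Vec ℕ n) (b : ℕ) → Good ρ b → 1 < b → ∀ r → r 1 ≡ 0 →
    Exec∃ (compileArgs ts ρ b) r (λ r′ → V.map r′ (regsFrom b k) ≡ g (V.map r ρ) × (∀ w → w < b → r′ w ≡ r w))
  compileArgs-ok [] ρ b g 1<b r z = r , skip , refl , λ _ _ → refl
  compileArgs-ok (_∷_ {g = gs} t ts) ρ b g 1<b r z =
    compile-ok t ρ b (suc b) g′ (λ i → <⇒≢ (proj₁ (g i))) ≤-refl (<⇒≢ 1<b ∘ sym) (m≤n⇒m≤1+n 1<b) r z ▷ λ r₁ (e₁ , f₁) →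
    weaken (λ r₂ (e₂ , f₂) →
        cong₂ _∷_ (trans (f₂ b ≤-refl) e₁)
          (trans e₂ (cong gs (map-agree _ _ ρ (λ i → f₁ _ (m≤n⇒m≤1+n (proj₁ (g i))) (<⇒≢ (proj₁ (g i))))))) ,
        λ w p → trans (f₂ w (m≤n⇒m≤1+n p)) (f₁ w (m≤n⇒m≤1+n p) (<⇒≢ p)))
      (compileArgs-ok ts ρ (suc b) g′ (m≤n⇒m≤1+n 1<b) r₁ (trans (f₁ 1 (m≤n⇒m≤1+n 1<b) (<⇒≢ 1<b)) z))
    where
    g′ : Good ρ (suc b)
    g′ i = m≤n⇒m≤1+n (proj₁ (g i)) , proj₂ (g i)

-- Register machines

len : Cmd → ℕ
len skip = 0
len (incr x) = 1
len (loop x c) = suc (len c + 1)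
len (c ⨾ d) = len c + len d

-- Jump targets are absolute, whence the start address `off`. The exit of a loop,
-- `suc off + (len c + 1)`, lies just past the jump `dec 1 off` back to its test.
code : ℕ → Cmd → List Instr
code off skip = []
code off (incr x) = inc x ∷ []
code off (loop x c) = dec x (suc off + (len c + 1)) ∷ code (suc off) c ++ dec 1 off ∷ []
code off (c ⨾ d) = code off c ++ code (off + len c) d

length-code : ∀ off c → length (code off c) ≡ len c
length-code off skip = refl
length-code off (incr x) = refl
length-code off (loop x c) = cong suc (trans (length-++ (code (suc off) c)) (cong (_+ 1) (length-code (suc off) c)))
length-code off (c ⨾ d) = trans (length-++ (code off c)) (cong₂ _+_ (length-code off c) (length-code (off + len c) d))

nth-++ˡ : ∀ {A : Set} (l m : List A) i {x} → nth l i ≡ just x → nth (l ++ m) i ≡ just x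
nth-++ˡ (y ∷ l) m zero e = e
nth-++ˡ (y ∷ l) m (suc i) e = nth-++ˡ l m i e

nth-++ʳ : ∀ {A : Set} (l m : List A) i → nth (l ++ m) (length l + i) ≡ nth m i
nth-++ʳ [] m i = refl
nth-++ʳ (y ∷ l) m i = nth-++ʳ l m i

record At (p : List Instr) (off : ℕ) (l : List Instr) : Set where
  constructor at
  field get : ∀ i {x} → nth l i ≡ just x → nth p (off + i) ≡ just x

At-++ˡ : ∀ {p off} l m → At p off (l ++ m) → At p off l
At-++ˡ l m (at a) = at λ i e → a i (nth-++ˡ l m i e)

At-++ʳ : ∀ {p off} l m {n} → length l ≡ n → At p off (l ++ m) → At p (off + n) m
At-++ʳ {p} {off} l m refl (at a) = at λ i {x} e →
  subst (λ z → nth p z ≡ just x) (sym (+-assoc off (length l) i)) (a (length l + i) (trans (nth-++ʳ l m i) e))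

At-tail : ∀ {p off y l} → At p off (y ∷ l) → At p (suc off) l
At-tail {p} {off} (at a) = at λ i {x} e → subst (λ z → nth p z ≡ just x) (+-suc off i) (a (suc i) e)

At-head : ∀ {p off y l} → At p off (y ∷ l) → nth p off ≡ just y
At-head {p} {off} (at a) = subst (λ z → nth p z ≡ just _) (+-identityʳ off) (a 0 refl)

data Step (p : List Instr) : ℕ → State → ℕ → State → Set where
  inc  : ∀ {pc r x} → nth p pc ≡ just (inc x) → Step p pc r (suc pc) (upd r x (suc (r x)))
  dec0 : ∀ {pc r x j} → nth p pc ≡ just (dec x j) → r x ≡ 0 → Step p pc r j r
  decS : ∀ {pc r x j v} → nth p pc ≡ just (dec x j) → r x ≡ suc v → Step p pc r (suc pc) (upd r x v)

data Steps (p : List Instr) : ℕ → State → ℕ → State → Set where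
  []  : ∀ {pc r} → Steps p pc r pc r
  _∷_ : ∀ {pc r pc₁ r₁ pc₂ r₂} → Step p pc r pc₁ r₁ → Steps p pc₁ r₁ pc₂ r₂ → Steps p pc r pc₂ r₂

_++ˢ_ : ∀ {p pc r pc₁ r₁ pc₂ r₂} → Steps p pc r pc₁ r₁ → Steps p pc₁ r₁ pc₂ r₂ → Steps p pc r pc₂ r₂
[] ++ˢ t = t
(s ∷ ss) ++ˢ t = s ∷ (ss ++ˢ t)

exec-steps : ∀ {p c r r′} off → At p off (code off c) → Exec c r r′ → Steps p off r (off + len c) r′
exec-steps {p} {r = r} off a skip = subst (λ z → Steps p off r z r) (sym (+-identityʳ off)) []
exec-steps {p} off a (incr {x} {r}) =
  subst (λ z → Steps p off r z (upd r x (suc (r x)))) (+-comm 1 off) (inc (At-head a) ∷ [])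
exec-steps {p} off a (seq {c} {d} {r} {r₁} {r₂} ex ex′) =
  subst (λ z → Steps p off r z r₂) (+-assoc off (len c) (len d))
    (exec-steps off (At-++ˡ (code off c) _ a) ex ++ˢ
     exec-steps (off + len c) (At-++ʳ (code off c) _ (length-code off c) a) ex′)
exec-steps {p} off a (loop0 {x} {c} {r} e) =
  subst (λ z → Steps p off r z r) (sym (+-suc off (len c + 1))) (dec0 (At-head a) e ∷ [])
exec-steps {p} off a (loopS {x} {c} {r} {v} {r₁} {r₂} e ex z exl) =
  decS (At-head a) e ∷
  (exec-steps (suc off) (At-++ˡ (code (suc off) c) _ (At-tail a)) ex ++ˢ
   (dec0 (At-head (At-++ʳ (code (suc off) c) _ (length-code (suc off) c) (At-tail a))) z ∷ exec-steps off a exl))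

run-step : ∀ {p pc r pc′ r′} f → Step p pc r pc′ r′ → run (suc f) p pc r ≡ run f p pc′ r′
run-step f (inc e) rewrite e = refl
run-step f (dec0 e z) rewrite e | z = refl
run-step f (decS e z) rewrite e | z = refl

run-zero : ∀ {p pc r pc′ r′} → Step p pc r pc′ r′ → run 0 p pc r ≡ nothing
run-zero (inc e) rewrite e = refl
run-zero (dec0 e z) rewrite e = refl
run-zero (decS e z) rewrite e = refl

run-halt : ∀ {p pc r} f → nth p pc ≡ nothing → run f p pc r ≡ just r
run-halt f e rewrite e = refl

Halts : List Instr → ℕ → State → Set
Halts p pc r = Σ ℕ λ f → Σ State λ r′ → run f p pc r ≡ just r′

steps-halts : ∀ {p pc r pc′ r′} → Steps p pc r pc′ r′ → Halts p pc′ r′ → Halts p pc r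
steps-halts [] h = h
steps-halts (s ∷ ss) h with steps-halts ss h
... | f , q , e = suc f , q , trans (run-step f s) e

-- The machine is deterministic, so a halting run has to pass through the given steps.
steps-halts⁻ : ∀ {p pc r pc′ r′} → Steps p pc r pc′ r′ → ∀ f {q} → run f p pc r ≡ just q →
  Σ ℕ λ f′ → f′ ≤ f × run f′ p pc′ r′ ≡ just q
steps-halts⁻ [] f e = f , ≤-refl , e
steps-halts⁻ (s ∷ ss) zero e with trans (sym (run-zero s)) e
... | ()
steps-halts⁻ (s ∷ ss) (suc f) e with steps-halts⁻ ss f (trans (sym (run-step f s)) e)
... | f′ , le , e′ = f′ , m≤n⇒m≤1+n le , e′

-- Unbounded search: g (d , x , s) = 0 signals success at s. The register 3 is the loop flag, 4 holds s.

module Search {g : Vec ℕ 3 → ℕ} (t : Comp 3 g) where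

  args : Vec ℕ 3
  args = 2 ∷ 0 ∷ 4 ∷ []

  body search : Cmd
  body = compile t args 3 5 ⨾ incr 4
  search = loop 3 body

  Inv : ℕ → ℕ → ℕ → State → Set
  Inv d x s r = r 2 ≡ d × r 0 ≡ x × r 4 ≡ s × r 1 ≡ 0

  body-ok : ∀ d x s v r → Inv d x s r →
    Exec∃ body (upd r 3 v) (λ r′ → r′ 3 ≡ g (d ∷ x ∷ s ∷ []) × Inv d x (suc s) r′)
  body-ok d x s v r (refl , refl , refl , z) =
    compile-ok t args 3 5
      (λ { F.zero → s≤s (s≤s (s≤s z≤n)) , (λ ()) ; (F.suc F.zero) → s≤s z≤n , (λ ())
         ; (F.suc (F.suc F.zero)) → ≤-refl , (λ ()) })
      (λ { F.zero → λ () ; (F.suc F.zero) → λ () ; (F.suc (F.suc F.zero)) → λ () })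
      (s≤s (s≤s (s≤s (s≤s z≤n)))) (λ ()) (s≤s (s≤s z≤n)) (upd r 3 v) z ▷ λ r₁ (e , f) →
    upd r₁ 4 (suc (r₁ 4)) , incr , e ,
      (f 2 (s≤s (s≤s (s≤s z≤n))) (λ ())) , f 0 (s≤s z≤n) (λ ()) ,
      cong suc (f 4 ≤-refl (λ ())) , trans (f 1 (s≤s (s≤s z≤n)) (λ ())) z

  -- `k` is the distance from `s` to a known success. The search may also stop earlier, at another
  -- zero of `g`.
  search-ok : ∀ d x k s v r → g (d ∷ x ∷ s + k ∷ []) ≡ 0 → Inv d x s r → r 3 ≡ suc v →
    Exec∃ search r (λ r′ → r′ 1 ≡ 0)
  search-ok d x k s v r gk i e with body-ok d x s v r i
  ... | r₁ , ex , e₁ , i₁@(_ , _ , _ , z₁) = go k (r₁ 3) refl gk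
    where
    go : ∀ k w → r₁ 3 ≡ w → g (d ∷ x ∷ s + k ∷ []) ≡ 0 → Exec∃ search r (λ r′ → r′ 1 ≡ 0)
    go k zero w≡ gk = r₁ , loopS e ex z₁ (loop0 w≡) , z₁
    go zero (suc w) w≡ gk rewrite +-identityʳ s with trans (sym w≡) (trans e₁ gk)
    ... | ()
    go (suc k) (suc w) w≡ gk with search-ok d x k (suc s) w r₁
        (subst (λ y → g (d ∷ x ∷ y ∷ []) ≡ 0) (+-suc s k) gk) i₁ w≡
    ... | r₂ , ex₂ , z₂ = r₂ , loopS e ex z₁ ex₂ , z₂

  -- The recursion is on the bound `F`, because the fuel left after one round is known only up to an
  -- inequality.
  search-sound : ∀ {p} off → At p off (code off search) → ∀ d x F f → f ≤ F → ∀ s v r {q} → Inv d x s r → r 3 ≡ suc v →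
    run f p off r ≡ just q → Σ ℕ λ s → g (d ∷ x ∷ s ∷ []) ≡ 0
  search-sound {p} off a d x F zero le s v r i e h with trans (sym (run-zero (decS {p = p} {off} {r} (At-head a) e))) h
  ... | ()
  search-sound {p} off a d x (suc F) (suc f) (s≤s le) s v r i e h with body-ok d x s v r i
  ... | r₁ , ex , e₁ , i₁ with r₁ 3 in w
  ... | zero = s , sym e₁
  ... | suc v₁ with steps-halts⁻ (exec-steps (suc off) (At-++ˡ (code (suc off) body) _ (At-tail a)) ex ++ˢ
                 (dec0 (At-head (At-++ʳ (code (suc off) body) _ (length-code (suc off) body) (At-tail a)))
                       (proj₂ (proj₂ (proj₂ i₁))) ∷ []))
                 f (trans (sym (run-step f (decS {p = p} {off} {r} (At-head a) e))) h)
  ... | f₁ , le₁ , h₁ = search-sound off a d x F f₁ (≤-trans le₁ le) (suc s) v₁ r₁ i₁ w h₁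

-- Closure properties of primitive recursive functions

pattern #0 = F.zero
pattern #1 = F.suc F.zero
pattern #2 = F.suc (F.suc F.zero)
pattern #3 = F.suc (F.suc (F.suc F.zero))

F1 : (ℕ → ℕ) → Vec ℕ 1 → ℕ
F1 f (a ∷ []) = f a

F2 : (ℕ → ℕ → ℕ) → Vec ℕ 2 → ℕ
F2 f (a ∷ b ∷ []) = f a b

F3 : (ℕ → ℕ → ℕ → ℕ) → Vec ℕ 3 → ℕ
F3 f (a ∷ b ∷ c ∷ []) = f a b c

def1 : ∀ {f g} → Comp 1 g → (∀ a → g (a ∷ []) ≡ f a) → Comp 1 (F1 f)
def1 c e = ext (λ { (a ∷ []) → e a }) c

def2 : ∀ {f g} → Comp 2 g → (∀ a b → g (a ∷ b ∷ []) ≡ f a b) → Comp 2 (F2 f)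
def2 c e = ext (λ { (a ∷ b ∷ []) → e a b }) c

def3 : ∀ {f g} → Comp 3 g → (∀ a b d → g (a ∷ b ∷ d ∷ []) ≡ f a b d) → Comp 3 (F3 f)
def3 c e = ext (λ { (a ∷ b ∷ d ∷ []) → e a b d }) c

app1 : ∀ {n f g} → Comp 1 (F1 f) → Comp n g → Comp n (λ ρ → f (g ρ))
app1 c a = call c (a ∷ [])

app2 : ∀ {n f g h} → Comp 2 (F2 f) → Comp n g → Comp n h → Comp n (λ ρ → f (g ρ) (h ρ))
app2 c a b = call c (a ∷ b ∷ [])

app3 : ∀ {n f g h k} → Comp 3 (F3 f) → Comp n g → Comp n h → Comp n k → Comp n (λ ρ → f (g ρ) (h ρ) (k ρ))
app3 c a b d = call c (a ∷ b ∷ d ∷ [])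

konst : ∀ {n} m → Comp n (λ _ → m)
konst zero = ze
konst (suc m) = su (konst m)

iter : (ℕ → ℕ) → ℕ → ℕ → ℕ
iter f a n = natrec a (λ _ → f) n

iter-suc : ∀ f a n → iter f a (suc n) ≡ iter f (f a) n
iter-suc f a zero = refl
iter-suc f a (suc n) = cong f (iter-suc f a n)

iter-fix : ∀ f a → f a ≡ a → ∀ n → iter f a n ≡ a
iter-fix f a e zero = refl
iter-fix f a e (suc n) = trans (cong f (iter-fix f a e n)) e

ifz : ℕ → ℕ → ℕ → ℕ
ifz zero a b = a
ifz (suc _) a b = b

ifzF : Comp 3 (F3 ifz)
ifzF = def3 (rec (var #1) (var (F.suc (F.suc #2))) (var #0)) λ { zero b c → refl ; (suc a) b c → refl }

addF : Comp 2 (F2 _+_)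
addF = def2 (rec (var #1) (su (var #0)) (var #0)) lem
  where
  lem : ∀ a b → natrec b (λ _ r → suc r) a ≡ a + b
  lem zero b = refl
  lem (suc a) b = cong suc (lem a b)

mulF : Comp 2 (F2 _*_)
mulF = def2 (rec ze (app2 addF (var #3) (var #0)) (var #0)) lem
  where
  lem : ∀ a b → natrec 0 (λ _ r → b + r) a ≡ a * b
  lem zero b = refl
  lem (suc a) b = cong (b +_) (lem a b)

predF : Comp 1 (F1 pred)
predF = def1 (rec ze (var #1) (var #0)) λ { zero → refl ; (suc a) → refl }

monusF : Comp 2 (F2 _∸_)
monusF = def2 (rec (var #0) (app1 predF (var #0)) (var #1)) lem
  where
  lem : ∀ a b → natrec a (λ _ r → pred r) b ≡ a ∸ b
  lem a zero = refl
  lem a (suc b) = trans (cong pred (lem a b)) (pred[m∸n]≡m∸[1+n] a b)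

diff : ℕ → ℕ → ℕ
diff a b = (a ∸ b) + (b ∸ a)

diffF : Comp 2 (F2 diff)
diffF = def2 (app2 addF (app2 monusF (var #0) (var #1)) (app2 monusF (var #1) (var #0))) λ _ _ → refl

diff-refl : ∀ a → diff a a ≡ 0
diff-refl a = cong₂ _+_ (n∸n≡0 a) (n∸n≡0 a)

diff≡0 : ∀ a b → diff a b ≡ 0 → a ≡ b
diff≡0 a b e = ≤-antisym (m∸n≡0⇒m≤n (m+n≡0⇒m≡0 (a ∸ b) e)) (m∸n≡0⇒m≤n (m+n≡0⇒n≡0 (a ∸ b) e))

oddℕ : ℕ → ℕ
oddℕ n = if odd n then 1 else 0

oddℕ-suc : ∀ n → 1 ∸ oddℕ n ≡ oddℕ (suc n)
oddℕ-suc zero = refl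
oddℕ-suc (suc zero) = refl
oddℕ-suc (suc (suc n)) = oddℕ-suc n

oddF : Comp 1 (F1 oddℕ)
oddF = def1 (rec ze (app2 monusF (konst 1) (var #0)) (var #0)) lem
  where
  lem : ∀ a → natrec 0 (λ _ r → 1 ∸ r) a ≡ oddℕ a
  lem zero = refl
  lem (suc a) = trans (cong (1 ∸_) (lem a)) (oddℕ-suc a)

halfF : Comp 1 (F1 ⌊_/2⌋)
halfF = def1 (rec ze (app2 addF (app1 oddF (var #1)) (var #0)) (var #0)) lem
  where
  half-suc : ∀ n → oddℕ n + ⌊ n /2⌋ ≡ ⌊ suc n /2⌋
  half-suc zero = refl
  half-suc (suc zero) = refl
  half-suc (suc (suc n)) = trans (+-suc (oddℕ n) ⌊ n /2⌋) (cong suc (half-suc n))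
  lem : ∀ a → natrec 0 (λ i r → oddℕ i + r) a ≡ ⌊ a /2⌋
  lem zero = refl
  lem (suc a) = trans (cong (oddℕ a +_) (lem a)) (half-suc a)

pow2F : Comp 1 (F1 (2 ^_))
pow2F = def1 (rec (konst 1) (app2 mulF (konst 2) (var #0)) (var #0)) lem
  where
  lem : ∀ a → natrec 1 (λ _ r → 2 * r) a ≡ 2 ^ a
  lem zero = refl
  lem (suc a) = cong (2 *_) (lem a)

pairF : Comp 2 (F2 pair)
pairF = def2 (app2 monusF (app2 mulF (app1 pow2F (var #0)) (su (app2 mulF (konst 2) (var #1)))) (konst 1)) λ _ _ → refl

consF : Comp 2 (F2 _∷ᶜ_)
consF = def2 (su (app2 pairF (var #0) (var #1))) λ _ _ → refl

halves : ℕ → ℕ → ℕ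
halves = iter ⌊_/2⌋

halvesF : Comp 2 (F2 halves)
halvesF = def2 (rec (var #0) (app1 halfF (var #0)) (var #1)) λ _ _ → refl

-- split recurses on halves of its argument; rec keeps the argument fixed, so step j works on
-- the argument halved f ∸ suc j times.
module _ (f n : ℕ) where
  splitStep₁ splitStep₂ : ℕ → ℕ → ℕ
  splitStep₁ j r = ifz (oddℕ (halves n (f ∸ suc j))) (suc r) 0
  splitStep₂ j r = ifz (oddℕ (halves n (f ∸ suc j))) r ⌊ halves n (f ∸ suc j) /2⌋

  split-natrec : ∀ j → j ≤ f →
    natrec 0 splitStep₁ j ≡ proj₁ (split j (halves n (f ∸ j))) ×
    natrec 0 splitStep₂ j ≡ proj₂ (split j (halves n (f ∸ j)))
  split-natrec zero _ = refl , refl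
  split-natrec (suc j) j<f with split-natrec j (<⇒≤ j<f)
  ... | e₁ , e₂ with odd (halves n (f ∸ suc j))
  ... | true = refl , refl
  ... | false = cong suc (trans e₁ (cong (λ z → proj₁ (split j (halves n z))) (+-∸-assoc 1 j<f))) ,
                trans e₂ (cong (λ z → proj₂ (split j (halves n z))) (+-∸-assoc 1 j<f))

fstF : Comp 1 (F1 fst)
fstF = def1 (rec ze (app3 ifzF (app1 oddF (app2 halvesF (su (var #2)) (app2 monusF (su (var #2)) (su (var #1))))) (su (var #0)) ze)
    (su (var #0)))
  λ a → trans (proj₁ (split-natrec (suc a) (suc a) (suc a) ≤-refl))
    (trans (cong (λ z → proj₁ (split (suc a) (halves (suc a) z))) (n∸n≡0 a)) (sym (fst≡ a)))

sndF : Comp 1 (F1 snd)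
sndF = def1 (rec ze (app3 ifzF (app1 oddF h) (var #0) (app1 halfF h)) (su (var #0)))
  λ a → trans (proj₂ (split-natrec (suc a) (suc a) (suc a) ≤-refl))
    (trans (cong (λ z → proj₂ (split (suc a) (halves (suc a) z))) (n∸n≡0 a)) (sym (snd≡ a)))
  where
  h : Comp 3 (λ ρ → _)
  h = app2 halvesF (su (var #2)) (app2 monusF (su (var #2)) (su (var #1)))

-- A primitive recursive simulation of register machines

hd tl : ℕ → ℕ
hd n = fst (pred n)
tl n = snd (pred n)

hdF : Comp 1 (F1 hd)
hdF = def1 (app1 fstF (app1 predF (var #0))) λ _ → refl

tlF : Comp 1 (F1 tl)
tlF = def1 (app1 sndF (app1 predF (var #0))) λ _ → refl

hd-0 : hd 0 ≡ 0
hd-0 = fst≡ 0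

tl-0 : tl 0 ≡ 0
tl-0 = snd≡ 0

drop : ℕ → ℕ → ℕ
drop = iter tl

dropF : Comp 2 (F2 drop)
dropF = def2 (rec (var #0) (app1 tlF (var #0)) (var #1)) λ _ _ → refl

-- A register assignment is coded by an association list whose earlier entries take precedence.

skipTo : ℕ → ℕ → ℕ
skipTo y n = ifz n 0 (ifz (diff (fst (hd n)) y) n (tl n))

skipToF : Comp 2 (F2 skipTo)
skipToF = def2 (app3 ifzF (var #1) ze (app3 ifzF (app2 diffF (app1 fstF (app1 hdF (var #1))) (var #0)) (var #1) (app1 tlF (var #1))))
  λ _ _ → refl

opaque
  look : ℕ → ℕ → ℕ
  look n y = snd (hd (iter (skipTo y) n n))

  lookF : Comp 2 (F2 look)
  lookF = def2 (app1 sndF (app1 hdF (rec (var #0) (app2 skipToF (var #3) (var #0)) (var #0)))) λ _ _ → refl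

proj₂-split≤ : ∀ f n → proj₂ (split f n) ≤ ⌊ n /2⌋
proj₂-split≤ zero n = z≤n
proj₂-split≤ (suc f) n with odd n
... | true = ≤-refl
... | false = ≤-trans (proj₂-split≤ f ⌊ n /2⌋) (⌊n/2⌋≤n ⌊ n /2⌋)

snd-≤ : ∀ m → snd m ≤ m
snd-≤ m = ≤-trans (≤-reflexive (snd≡ m)) (≤-trans (proj₂-split≤ (suc m) (suc m)) (≤-pred (⌊n/2⌋<n m)))

ifz-cases : ∀ c (a b : ℕ) → (c ≡ 0 × ifz c a b ≡ a) ⊎ (∃ λ d → c ≡ suc d × ifz c a b ≡ b)
ifz-cases zero a b = inj₁ (refl , refl)
ifz-cases (suc c) a b = inj₂ (c , refl , refl)

-- Each tail has a smaller code than its list, so the code of a list bounds the number of entries to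
-- be skipped, and further iterations change nothing.
skipTo-stable : ∀ y f n k → n ≤ f → n ≤ k → iter (skipTo y) n k ≡ iter (skipTo y) n n
skipTo-stable y f zero k _ _ = iter-fix (skipTo y) 0 refl k
skipTo-stable y (suc f) (suc m) (suc k) (s≤s m≤f) (s≤s m≤k) with ifz-cases (diff (fst (hd (suc m))) y) (suc m) (tl (suc m))
... | inj₁ (_ , e) = trans (iter-fix (skipTo y) (suc m) e (suc k)) (sym (iter-fix (skipTo y) (suc m) e (suc m)))
... | inj₂ (_ , _ , e) = trans (go k m≤k) (sym (go m ≤-refl))
  where
  go : ∀ k → m ≤ k → iter (skipTo y) (suc m) (suc k) ≡ iter (skipTo y) (snd m) (snd m)
  go k m≤k = trans (iter-suc (skipTo y) (suc m) k) (trans (cong (λ z → iter (skipTo y) z k) e)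
    (skipTo-stable y f (snd m) k (≤-trans (snd-≤ m) m≤f) (≤-trans (snd-≤ m) m≤k)))

skipTo-here : ∀ y v l → skipTo y (pair y v ∷ᶜ l) ≡ pair y v ∷ᶜ l
skipTo-here y v l rewrite fst-pair (pair y v) l | fst-pair y v | diff-refl y = refl

skipTo-there : ∀ x y v l → y ≢ x → skipTo y (pair x v ∷ᶜ l) ≡ l
skipTo-there x y v l p with ifz-cases (diff (fst (hd (pair x v ∷ᶜ l))) y) (pair x v ∷ᶜ l) (tl (pair x v ∷ᶜ l))
... | inj₁ (e , _) = ⊥-elim (p (sym (trans (sym (trans (cong fst (fst-pair (pair x v) l)) (fst-pair x v))) (diff≡0 _ y e))))
... | inj₂ (_ , _ , e) = trans e (snd-pair (pair x v) l)

opaque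
  unfolding look

  look-0 : ∀ y → look 0 y ≡ 0
  look-0 y = trans (cong snd hd-0) (snd≡ 0)

  look-here : ∀ l y v → look (pair y v ∷ᶜ l) y ≡ v
  look-here l y v = begin
    snd (hd (iter (skipTo y) n n)) ≡⟨ cong (λ z → snd (hd z)) (iter-fix (skipTo y) n (skipTo-here y v l) n) ⟩
    snd (hd n)                     ≡⟨ cong snd (fst-pair (pair y v) l) ⟩
    snd (pair y v)                 ≡⟨ snd-pair y v ⟩
    v                              ∎
    where
    open ≡-Reasoning
    n : ℕ
    n = pair y v ∷ᶜ l

  look-there : ∀ l x y v → y ≢ x → look (pair x v ∷ᶜ l) y ≡ look l y
  look-there l x y v p = cong (λ z → snd (hd z)) (begin
    iter (skipTo y) (suc m) (suc m)       ≡⟨ iter-suc (skipTo y) (suc m) m ⟩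
    iter (skipTo y) (skipTo y (suc m)) m  ≡⟨ cong (λ z → iter (skipTo y) z m) (skipTo-there x y v l p) ⟩
    iter (skipTo y) l m                   ≡⟨ skipTo-stable y l l m ≤-refl (snd≤ (pair x v) l) ⟩
    iter (skipTo y) l l                   ∎)
    where
    open ≡-Reasoning
    m : ℕ
    m = pair (pair x v) l

look-upd : ∀ l r x v → (∀ y → look l y ≡ r y) → ∀ y → look (pair x v ∷ᶜ l) y ≡ upd r x v y
look-upd l r x v h y = go (y ≟ x)
  where
  go : Dec (y ≡ x) → look (pair x v ∷ᶜ l) y ≡ upd r x v y
  go (yes refl) = trans (look-here l y v) (sym (upd-same r y v))
  go (no p) = trans (look-there l x y v p) (trans (h y) (sym (upd-other r x v y p)))

opaque
  -- Writing also advances the program counter, since an instruction that changes a register always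
  -- continues with the next one.
  store : ℕ → ℕ → ℕ → ℕ
  store st x v = pair (suc (fst st)) (pair x v ∷ᶜ snd st)

  storeF : Comp 3 (F3 store)
  storeF = def3 (app2 pairF (su (app1 fstF (var #0))) (app2 consF (app2 pairF (var #1) (var #2)) (app1 sndF (var #0)))) λ _ _ _ → refl

-- Effects of the instructions inc q and (for q = pair x j) dec x j on a machine state pair pc registers.
opaque
  doInc doDec : ℕ → ℕ → ℕ
  doInc st q = store st q (suc (look (snd st) q))
  doDec st q = ifz (look (snd st) (fst q)) (pair (snd q) (snd st)) (store st (fst q) (pred (look (snd st) (fst q))))

  doIncF : Comp 2 (F2 doInc)
  doIncF = def2 (app3 storeF (var #0) (var #1) (su (app2 lookF (app1 sndF (var #0)) (var #1)))) λ _ _ → refl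

  doDecF : Comp 2 (F2 doDec)
  doDecF = let v = app2 lookF (app1 sndF (var #0)) (app1 fstF (var #1)) in
    def2 (app3 ifzF v (app2 pairF (app1 sndF (var #1)) (app1 sndF (var #0))) (app3 storeF (var #0) (app1 fstF (var #1)) (app1 predF v)))
    λ _ _ → refl

opaque
  stepCode : ℕ → ℕ → ℕ
  stepCode st i = ifz (oddℕ i) (doInc st ⌊ i /2⌋) (doDec st ⌊ i /2⌋)

  stepCodeF : Comp 2 (F2 stepCode)
  stepCodeF = def2 (app3 ifzF (app1 oddF (var #1)) (app2 doIncF (var #0) (app1 halfF (var #1))) (app2 doDecF (var #0) (app1 halfF (var #1))))
    λ _ _ → refl

opaque
  -- Only the empty list has code 0, so `drop e (fst st)` vanishes exactly when the counter has left
  -- the program. A halted state is kept.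
  stepN : ℕ → ℕ → ℕ
  stepN e st = ifz (drop e (fst st)) st (stepCode st (hd (drop e (fst st))))

  stepF : Comp 2 (F2 stepN)
  stepF = let d = app2 dropF (var #0) (app1 fstF (var #1)) in
    def2 (app3 ifzF d (var #1) (app2 stepCodeF (var #1) (app1 hdF d))) λ _ _ → refl

opaque
  outN : ℕ → ℕ → ℕ
  outN e st = ifz (drop e (fst st)) (suc (look (snd st) 0)) 0

  outF : Comp 2 (F2 outN)
  outF = def2 (app3 ifzF (app2 dropF (var #0) (app1 fstF (var #1))) (su (app2 lookF (app1 sndF (var #1)) ze)) ze) λ _ _ → refl

initN : ℕ → ℕ
initN x = pair 0 (pair 0 x ∷ᶜ 0)

toOut : Maybe State → ℕ
toOut nothing = 0
toOut (just r) = suc (r 0)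

opaque
  simOut : ℕ → ℕ → ℕ → ℕ
  simOut e x s = toOut (run s (decodeProg e) 0 (input x))

decodeProg-suc : ∀ m → decodeProg (suc m) ≡ decodeInstr (fst m) ∷ decodeProg (snd m)
decodeProg-suc m = cong (map decodeInstr) (decodeList-suc m)

nth-drop : ∀ e pc → (drop e pc ≡ 0 × nth (decodeProg e) pc ≡ nothing) ⊎
  (∃ λ m → drop e pc ≡ suc m × nth (decodeProg e) pc ≡ just (decodeInstr (hd (drop e pc))))
nth-drop zero zero = inj₁ (refl , refl)
nth-drop zero (suc pc) = inj₁ (iter-fix tl 0 tl-0 (suc pc) , refl)
nth-drop (suc m) zero rewrite decodeProg-suc m = inj₂ (m , refl , refl)
nth-drop (suc m) (suc pc) rewrite decodeProg-suc m | iter-suc tl (suc m) pc = nth-drop (snd m) pc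

Rep : ℕ → ℕ → State → Set
Rep st pc r = fst st ≡ pc × (∀ y → look (snd st) y ≡ r y)

Rep-pair : ∀ {l pc r} → (∀ y → look l y ≡ r y) → Rep (pair pc l) pc r
Rep-pair {l} {pc} h = fst-pair pc l , λ y → trans (cong (λ z → look z y) (snd-pair pc l)) (h y)

opaque
  unfolding store

  Rep-store : ∀ {st pc r x v} → Rep st pc r → Rep (store st x v) (suc pc) (upd r x v)
  Rep-store {st} {r = r} {x} {v} (refl , h) = Rep-pair (look-upd (snd st) r x v h)

just-dec : ∀ q → just (dec (proj₁ (unpair q)) (proj₂ (unpair q))) ≡ just (dec (fst q) (snd q))
just-dec q = sym (cong₂ (λ a b → just (dec a b)) (fst≡ q) (snd≡ q))

opaque
  unfolding doInc doDec stepCode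

  step-exists : ∀ p {pc r} st i → nth p pc ≡ just (decodeInstr i) → Rep st pc r →
    Σ ℕ λ pc′ → Σ State λ r′ → Step p pc r pc′ r′ × Rep (stepCode st i) pc′ r′
  step-exists p {pc} {r} st i e rep@(_ , h) with odd i
  ... | false = _ , _ , inc e , subst (λ z → Rep (store st ⌊ i /2⌋ (suc z)) (suc pc) (upd r ⌊ i /2⌋ (suc (r ⌊ i /2⌋)))) (sym (h ⌊ i /2⌋)) (Rep-store rep)
  ... | true with look (snd st) (fst ⌊ i /2⌋) | h (fst ⌊ i /2⌋)
  ... | zero | hq = _ , _ , dec0 (trans e (just-dec ⌊ i /2⌋)) (sym hq) , Rep-pair h
  ... | suc v | hq = _ , _ , decS (trans e (just-dec ⌊ i /2⌋)) (sym hq) , Rep-store rep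

opaque
  unfolding stepN outN

  sim-run : ∀ e s st pc r → Rep st pc r → outN e (iter (stepN e) st s) ≡ toOut (run s (decodeProg e) pc r)
  sim-run e s st pc r rep@(refl , h) with nth-drop e (fst st)
  ... | inj₁ (d , n) = trans (cong (outN e) (iter-fix (stepN e) st (cong (λ z → ifz z st (stepCode st (hd z))) d) s))
    (trans (cong (λ z → ifz z (suc (look (snd st) 0)) 0) d) (trans (cong suc (h 0)) (cong toOut (sym (run-halt {decodeProg e} {fst st} {r} s n)))))
  ... | inj₂ (m , d , n) with step-exists (decodeProg e) st (hd (drop e (fst st))) n rep
  ... | pc′ , r′ , step , rep′ = go s
    where
    go : ∀ s → outN e (iter (stepN e) st s) ≡ toOut (run s (decodeProg e) (fst st) r)
    go zero = trans (cong (λ z → ifz z (suc (look (snd st) 0)) 0) d) (cong toOut (sym (run-zero step)))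
    go (suc s) = trans (cong (outN e) (trans (iter-suc (stepN e) st s)
        (cong (λ z → iter (stepN e) z s) (cong (λ z → ifz z st (stepCode st (hd (drop e (fst st))))) d))))
      (trans (sim-run e s _ pc′ r′ rep′) (cong toOut (sym (run-step s step))))

Rep-init : ∀ x → Rep (initN x) 0 (input x)
Rep-init x = Rep-pair λ y → trans (look-upd 0 (λ _ → 0) 0 x look-0 y) (lem y)
  where
  lem : ∀ y → upd (λ _ → 0) 0 x y ≡ input x y
  lem zero = refl
  lem (suc y) = refl

opaque
  unfolding simOut

  simF : Comp 3 (F3 simOut)
  simF = def3 (app2 outF (var #0) (rec (app2 pairF ze (app2 consF (app2 pairF ze (var #1)) ze)) (app2 stepF (var #2) (var #0)) (var #2)))
    λ e x s → sim-run e s (initN x) 0 (input x) (Rep-init x)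

-- The recursion theorem

encInstr : Instr → ℕ
encInstr (inc x) = 2 * x
encInstr (dec x j) = suc (2 * pair x j)

decode-encInstr : ∀ i → decodeInstr (encInstr i) ≡ i
decode-encInstr (inc x) rewrite odd-2* x | half-2* x = refl
decode-encInstr (dec x j) rewrite odd-1+2* (pair x j) | half-1+2* (pair x j) =
  cong (λ u → dec (proj₁ u) (proj₂ u)) (unpair-pair x j)

encProg : List Instr → ℕ
encProg p = encodeList (map encInstr p)

decode-encProg : ∀ p → decodeProg (encProg p) ≡ p
decode-encProg p = trans (cong (map decodeInstr) (decode-encode (map encInstr p))) (go p)
  where
  go : ∀ p → map decodeInstr (map encInstr p) ≡ p
  go [] = refl
  go (i ∷ p) = cong₂ _∷_ (decode-encInstr i) (go p)

-- The code of `l ++ m` is an affine function of the code of `m`; this is its linear coefficient.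
slope : List ℕ → ℕ
slope [] = 1
slope (x ∷ l) = 2 * 2 ^ x * slope l

encodeList-++ : ∀ l m → encodeList (l ++ m) ≡ encodeList l + slope l * encodeList m
encodeList-++ [] m = sym (+-identityʳ (encodeList m))
encodeList-++ (x ∷ l) m = begin
  encodeList (x ∷ l ++ m)             ≡⟨ enc (l ++ m) ⟩
  2 ^ x * suc (2 * encodeList (l ++ m)) ≡⟨ cong (λ z → 2 ^ x * suc (2 * z)) (encodeList-++ l m) ⟩
  2 ^ x * suc (2 * (encodeList l + slope l * encodeList m)) ≡⟨ lem (2 ^ x) (encodeList l) (slope l) (encodeList m) ⟩
  2 ^ x * suc (2 * encodeList l) + 2 * 2 ^ x * slope l * encodeList m ≡⟨ cong (_+ slope (x ∷ l) * encodeList m) (enc l) ⟨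
  encodeList (x ∷ l) + slope (x ∷ l) * encodeList m ∎
  where
  open ≡-Reasoning
  enc : ∀ l → encodeList (x ∷ l) ≡ 2 ^ x * suc (2 * encodeList l)
  enc l = trans (encodeList-∷ x l) (∷ᶜ≡ x (encodeList l))
  lem : ∀ p a b c → p * suc (2 * (a + b * c)) ≡ p * suc (2 * a) + 2 * p * b * c
  lem = solve-∀

-- A program that stores d in register 2 by means of d instructions inc 2 placed after a prefix;
-- d describes the prefix, so that the program can compute its own code from d.

opaque
  jumpCode : ℕ
  jumpCode = encodeList (encInstr (dec 1 1) ∷ [])

  jumpCode≡ : jumpCode ≡ encodeList (encInstr (dec 1 1) ∷ [])
  jumpCode≡ = refl

loader : ℕ → List Instr
loader d = replicate d (inc 2) ++ dec 1 1 ∷ []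

-- 4 is the code of `inc 2`.
loaderCode : ℕ → ℕ
loaderCode = iter (4 ∷ᶜ_) jumpCode

loaderCode≡ : ∀ d → encProg (loader d) ≡ loaderCode d
loaderCode≡ zero = sym jumpCode≡
loaderCode≡ (suc d) = trans (encodeList-∷ 4 (map encInstr (loader d))) (cong (4 ∷ᶜ_) (loaderCode≡ d))

opaque
  -- `d` packs the code of the prefix together with its slope; appending `loader d` to the prefix
  -- thus becomes arithmetic in `d`.
  selfCode : ℕ → ℕ
  selfCode d = fst d + snd d * loaderCode d

  selfCodeF : Comp 1 (F1 selfCode)
  selfCodeF = def1 (app2 addF (app1 fstF (var #0)) (app2 mulF (app1 sndF (var #0))
    (rec (konst jumpCode) (app2 consF (konst 4) (var #0)) (var #0)))) λ _ → refl

  describe : List Instr → ℕ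
  describe p = pair (encProg p) (slope (map encInstr p))

  selfCode-describe : ∀ p → encProg (p ++ loader (describe p)) ≡ selfCode (describe p)
  selfCode-describe p = begin
    encodeList (map encInstr (p ++ loader d))  ≡⟨ cong encodeList (map-++ encInstr p (loader d)) ⟩
    encodeList (map encInstr p ++ map encInstr (loader d)) ≡⟨ encodeList-++ (map encInstr p) _ ⟩
    encProg p + slope (map encInstr p) * encProg (loader d)
      ≡⟨ cong₂ _+_ (fst-pair (encProg p) (slope (map encInstr p))) (cong₂ _*_ (snd-pair (encProg p) (slope (map encInstr p))) (sym (loaderCode≡ d))) ⟨
    selfCode d ∎
    where
    open ≡-Reasoning
    d : ℕ
    d = describe p

nth-length : ∀ {A : Set} (l : List A) → nth l (length l) ≡ nothing
nth-length [] = refl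
nth-length (x ∷ l) = nth-length l

load-steps : ∀ {p} d off r → At p off (replicate d (inc 2)) →
  Σ State λ r′ → Steps p off r (off + d) r′ × r′ 2 ≡ d + r 2 × (∀ w → w ≢ 2 → r′ w ≡ r w)
load-steps {p} zero off r a = r , subst (λ z → Steps p off r z r) (sym (+-identityʳ off)) [] , refl , λ _ _ → refl
load-steps {p} (suc d) off r a with load-steps d (suc off) (upd r 2 (suc (r 2))) (At-tail a)
... | r′ , ss , e , f = r′ , subst (λ z → Steps p off r z r′) (sym (+-suc off d)) (inc (At-head a) ∷ ss) ,
  trans e (+-suc d (r 2)) , λ w n → trans (f w n) (upd-other r 2 _ w n)

At-refl : ∀ p → At p 0 p
At-refl p = at λ i e → e

-- Instruction 0 jumps over `main` to the loader, which puts `d` into register 2 and returns to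
-- address 1 by `dec 1 1`. When `main` is over, `inc 1` makes register 1 positive, so that the
-- second passage through the loader decrements instead of jumping and runs off the end of the
-- program.
module Load (main : Cmd) where

  prefix : List Instr
  prefix = (dec 1 (suc (len main + 1)) ∷ code 1 main) ++ inc 1 ∷ []

  d : ℕ
  d = describe prefix

  prog : List Instr
  prog = prefix ++ loader d

  length-prefix : length prefix ≡ suc (len main + 1)
  length-prefix = cong suc (trans (length-++ (code 1 main)) (cong (_+ 1) (length-code 1 main)))

  decode-self : decodeProg (selfCode d) ≡ prog
  decode-self = trans (cong decodeProg (sym (selfCode-describe prefix))) (decode-encProg prog)

  at-prefix : At prog 0 prefix
  at-prefix = At-++ˡ prefix (loader d) (At-refl prog)

  at-main : At prog 1 (code 1 main)
  at-main = At-++ˡ (code 1 main) _ (At-tail at-prefix)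

  at-loader : At prog (suc (len main + 1)) (loader d)
  at-loader = At-++ʳ prefix (loader d) length-prefix (At-refl prog)

  at-load : At prog (suc (len main + 1)) (replicate d (inc 2))
  at-load = At-++ˡ (replicate d (inc 2)) _ at-loader

  at-jump : At prog (suc (len main + 1) + d) (dec 1 1 ∷ [])
  at-jump = At-++ʳ (replicate d (inc 2)) _ (length-replicate d) at-loader

  start : ∀ x → Σ State λ r → Steps prog 0 (input x) 1 r × r 2 ≡ d × (∀ w → w ≢ 2 → r w ≡ input x w)
  start x with load-steps d (suc (len main + 1)) (input x) at-load
  ... | r , ss , e , f = r , dec0 (At-head at-prefix) refl ∷ (ss ++ˢ (dec0 (At-head at-jump) (f 1 λ ()) ∷ [])) ,
    trans e (+-identityʳ d) , f

  finish : ∀ r → r 1 ≡ 0 → Halts prog (1 + len main) r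
  finish r z with load-steps d (suc (len main + 1)) (upd r 1 (suc (r 1))) at-load
  ... | r′ , ss , e , f = steps-halts
      (inc (At-head at-inc) ∷ subst (λ k → Steps prog k (upd r 1 (suc (r 1))) end r₁) (cong suc (+-comm (len main) 1))
        (ss ++ˢ (decS (At-head at-jump) (trans (f 1 λ ()) (cong suc z)) ∷ [])))
      (0 , r₁ , run-halt {prog} {end} {r₁} 0 (subst (λ k → nth prog k ≡ nothing) len-prog (nth-length prog)))
    where
    r₁ = upd r′ 1 0
    end = suc (suc (len main + 1) + d)
    at-inc : At prog (1 + len main) (inc 1 ∷ [])
    at-inc = At-++ʳ (code 1 main) _ (length-code 1 main) (At-tail at-prefix)
    len-prog : length prog ≡ end
    len-prog = begin
      length (prefix ++ loader d)             ≡⟨ length-++ prefix ⟩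
      length prefix + length (loader d)
        ≡⟨ cong₂ _+_ length-prefix (trans (length-++ (replicate d (inc 2))) (cong (_+ 1) (length-replicate d))) ⟩
      suc (len main + 1) + (d + 1)            ≡⟨ +-assoc (suc (len main + 1)) d 1 ⟨
      suc (len main + 1) + d + 1              ≡⟨ +-comm _ 1 ⟩
      end ∎
      where open ≡-Reasoning

record SelfLoading (main : Cmd) : Set where
  field
    d : ℕ
    prog : List Instr
    decode-self : decodeProg (selfCode d) ≡ prog
    at-main : At prog 1 (code 1 main)
    start : ∀ x → Σ State λ r → Steps prog 0 (input x) 1 r × r 2 ≡ d × (∀ w → w ≢ 2 → r w ≡ input x w)
    finish : ∀ r → r 1 ≡ 0 → Halts prog (1 + len main) r

selfLoading : ∀ main → SelfLoading main
selfLoading main = record { Load main }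

module SearchProgram {g : Vec ℕ 3 → ℕ} (t : Comp 3 g) where
  open Search t

  module _ (L : SelfLoading (incr 3 ⨾ search)) where
    open SelfLoading L

    at-search : At prog 2 (code 2 search)
    at-search = At-tail at-main

    ready : ∀ x → Σ State λ r → Steps prog 0 (input x) 2 r × Inv d x 0 r × r 3 ≡ 1
    ready x with start x
    ... | r , ss , e , f = upd r 3 (suc (r 3)) , ss ++ˢ (inc (At-head at-main) ∷ []) ,
      (e , f 0 (λ ()) , f 4 (λ ()) , f 1 (λ ())) , cong suc (f 3 λ ())

    sound : ∀ x → W (selfCode d) x → Σ ℕ λ s → g (d ∷ x ∷ s ∷ []) ≡ 0
    sound x (y , f , q , e , _) with ready x
    ... | r , ss , i , e₃ with steps-halts⁻ ss f (subst (λ p → run f p 0 (input x) ≡ just q) decode-self e)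
    ... | f′ , _ , e′ = search-sound 2 at-search d x f′ f′ ≤-refl 0 0 r i e₃ e′

    complete : ∀ x s → g (d ∷ x ∷ s ∷ []) ≡ 0 → W (selfCode d) x
    complete x s gs with ready x
    ... | r , ss , i , e₃ with search-ok d x s 0 0 r gs i e₃
    ... | r′ , ex , z with steps-halts (ss ++ˢ exec-steps 2 at-search ex) (finish r′ z)
    ... | f , q , e = q 0 , f , q , subst (λ p → run f p 0 (input x) ≡ just q) (sym decode-self) e , refl

  abstract
    search-program : Σ ℕ λ d → ∀ x →
      (W (selfCode d) x → Σ ℕ λ s → g (d ∷ x ∷ s ∷ []) ≡ 0) × (∀ s → g (d ∷ x ∷ s ∷ []) ≡ 0 → W (selfCode d) x)
    search-program = SelfLoading.d L , λ x → sound L x , complete L x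
      where
      L : SelfLoading (incr 3 ⨾ search)
      L = selfLoading _

abstract
  onSelf : (Vec ℕ 3 → ℕ) → Vec ℕ 3 → ℕ
  onSelf h (d ∷ x ∷ s ∷ []) = h (selfCode d ∷ x ∷ s ∷ [])

  onSelf≡ : ∀ {h d x s} → onSelf h (d ∷ x ∷ s ∷ []) ≡ h (selfCode d ∷ x ∷ s ∷ [])
  onSelf≡ = refl

  onSelfF : ∀ {h} → Comp 3 h → Comp 3 (onSelf h)
  onSelfF c = ext (λ { (d ∷ x ∷ s ∷ []) → refl }) (call c (app1 selfCodeF (var #0) ∷ var #1 ∷ var #2 ∷ []))

-- The search program finds `d` in register 2 and computes its own index `selfCode d` from it, so
-- the searched predicate may refer to that index.
recursion : ∀ {h} → Comp 3 h → Σ ℕ λ e → ∀ x →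
  (W e x → Σ ℕ λ s → h (e ∷ x ∷ s ∷ []) ≡ 0) × (∀ s → h (e ∷ x ∷ s ∷ []) ≡ 0 → W e x)
recursion c with SearchProgram.search-program (onSelfF c)
... | d , p = selfCode d , λ x → (λ w → let (s , e) = proj₁ (p x) w in s , trans (sym onSelf≡) e) ,
  λ s e → proj₂ (p x) s (trans onSelf≡ e)

-- Computations and their simulation

run-more : ∀ p pc r f k {q} → run f p pc r ≡ just q → run (f + k) p pc r ≡ just q
run-more p pc r f k e with nth p pc
... | nothing = e
run-more p pc r (suc f) k e | just (inc x) = run-more p (suc pc) (upd r x (suc (r x))) f k e
run-more p pc r (suc f) k e | just (dec x j) with r x
... | zero = run-more p j r f k e
... | suc v = run-more p (suc pc) (upd r x v) f k e

toOut-suc : ∀ m {y} → toOut m ≡ suc y → Σ State λ r → m ≡ just r × r 0 ≡ y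
toOut-suc (just r) refl = r , refl , refl

opaque
  unfolding simOut

  out-sim : ∀ e x {y} → Out e x y → Σ ℕ λ s → simOut e x s ≡ suc y
  out-sim e x (s , r , h , refl) = s , cong toOut h

  sim-out : ∀ e x s {y} → simOut e x s ≡ suc y → Out e x y
  sim-out e x s h with toOut-suc (run s (decodeProg e) 0 (input x)) h
  ... | r , e₁ , e₂ = s , r , e₁ , e₂

  sim-more : ∀ {e x s y} k → simOut e x s ≡ suc y → simOut e x (s + k) ≡ suc y
  sim-more {e} {x} {s} k h with toOut-suc (run s (decodeProg e) 0 (input x)) h
  ... | r , e₁ , refl = cong toOut (run-more (decodeProg e) 0 (input x) s k e₁)

sim-mono : ∀ {e x s s′ y} → s ≤ s′ → simOut e x s ≡ suc y → simOut e x s′ ≡ suc y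
sim-mono {e} {x} {s} {s′} {y} le h = subst (λ z → simOut e x z ≡ suc y) (m+[n∸m]≡n le) (sim-more (s′ ∸ s) h)

out-unique : ∀ e x {y y′} → Out e x y → Out e x y′ → y ≡ y′
out-unique e x {y′ = y′} o o′ with out-sim e x o | out-sim e x o′
... | s , h | s′ , h′ = suc-injective (trans (sym (sim-more s′ h))
  (subst (λ z → simOut e x z ≡ suc y′) (+-comm s′ s) (sim-more s h′)))

-- Algebras and congruences

emptyIndex : Σ ℕ λ e → ∀ x → ¬ W e x
emptyIndex with recursion {λ _ → 1} (konst 1)
... | e , p = e , λ x w → case (proj₂ (proj₁ (p x) w))
  where
  case : 1 ≡ 0 → ⊥
  case ()

toFin-toℕ : ∀ n (i : Fin n) → toFin n (toℕ i) ≡ just i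
toFin-toℕ (suc n) F.zero = refl
toFin-toℕ (suc n) (F.suc i) rewrite toFin-toℕ n i = refl

varK-toℕ : ∀ k i → varK k (toℕ i) ≡ i
varK-toℕ k i rewrite toFin-toℕ (suc k) i = refl

listOf : ∀ {n} → (Fin n → ℕ) → List ℕ
listOf {zero} f = []
listOf {suc n} f = f F.zero ∷ listOf (f ∘ F.suc)

nthD-listOf : ∀ {n} (f : Fin n → ℕ) i → nthD (listOf f) (toℕ i) ≡ f i
nthD-listOf f F.zero = refl
nthD-listOf f (F.suc i) = nthD-listOf (f ∘ F.suc) i

listOf-< : ∀ {n} (f : Fin n → ℕ) i → f i < encodeList (listOf f)
listOf-< f F.zero rewrite encodeList-∷ (f F.zero) (listOf (f ∘ F.suc)) = a<∷ᶜ (f F.zero) (encodeList (listOf (f ∘ F.suc)))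
listOf-< f (F.suc i) rewrite encodeList-∷ (f F.zero) (listOf (f ∘ F.suc)) =
  <-trans (listOf-< (f ∘ F.suc) i) (b<∷ᶜ (f F.zero) (encodeList (listOf (f ∘ F.suc))))

module Algebra (𝒱 : Variety) where
  open Variety 𝒱
  open Sig sig

  Tm : ℕ → Set
  Tm n = Term sig (Fin n)

  Rel : ℕ → Set₁
  Rel n = Tm n → Tm n → Set

  _⊑_ : ∀ {n} → Rel n → Rel n → Set
  A ⊑ B = ∀ {t u} → A t u → B t u

  record Model {n} (θ : Rel n) : Set where
    field
      rfl′ : ∀ t → θ t t
      sym″ : ∀ {t u} → θ t u → θ u t
      trn′ : ∀ {t u w} → θ t u → θ u w → θ t w
      cng′ : ∀ f (ts us : Fin (arity f) → Tm n) → (∀ i → θ (ts i) (us i)) → θ (op f ts) (op f us)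
      law′ : ∀ m → W lawIdx m → (s : ℕ → Tm n) →
             θ (sub sig s (proj₁ (decPair sig (λ x → x) m))) (sub sig s (proj₂ (decPair sig (λ x → x) m)))

  open Model

  gen-model : ∀ {n} {R : Rel n} → Model (Gen 𝒱 R)
  gen-model = record { rfl′ = rfl ; sym″ = sym′ ; trn′ = trn ; cng′ = cng ; law′ = law }

  gen-min : ∀ {n} {R θ : Rel n} → Model θ → R ⊑ θ → Gen 𝒱 R ⊑ θ
  gen-min M h (base r) = h r
  gen-min M h (law m w s) = law′ M m w s
  gen-min M h (rfl t) = rfl′ M t
  gen-min M h (sym′ p) = sym″ M (gen-min M h p)
  gen-min M h (trn p q) = trn′ M (gen-min M h p) (gen-min M h q)
  gen-min M h (cng f ts us p) = cng′ M f ts us (λ i → gen-min M h (p i))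

  gen-mono : ∀ {n} {R S : Rel n} → R ⊑ S → Gen 𝒱 R ⊑ Gen 𝒱 S
  gen-mono h = gen-min gen-model (base ∘ h)

  hom-sub : ∀ {n p} {C : Rel p} (f : Tm n → Tm p) → Model C → Hom 𝒱 f C → ∀ {V : Set} (s : V → Tm n) t →
    C (f (sub sig s t)) (sub sig (f ∘ s) t)
  hom-sub f M hf s (var x) = rfl′ M _
  hom-sub f M hf s (op g ts) = trn′ M (hf g (λ i → sub sig s (ts i)))
    (cng′ M g _ _ (λ i → hom-sub f M hf s (ts i)))

  -- For a homomorphic `f` this is the kernel of `f` followed by the projection modulo `C`.
  pull : ∀ {n p} → (Tm n → Tm p) → Rel p → Rel n
  pull f C t u = C (f t) (f u)

  pull-model : ∀ {n p} {C : Rel p} (f : Tm n → Tm p) → Model C → Hom 𝒱 f C → Model (pull f C)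
  pull-model f M hf = record
    { rfl′ = λ t → rfl′ M (f t)
    ; sym″ = sym″ M
    ; trn′ = trn′ M
    ; cng′ = λ g ts us h → trn′ M (hf g ts) (trn′ M (cng′ M g _ _ h) (sym″ M (hf g us)))
    ; law′ = λ m w s → trn′ M (hom-sub f M hf s (proj₁ (decPair sig (λ x → x) m)))
        (trn′ M (law′ M m w (f ∘ s)) (sym″ M (hom-sub f M hf s (proj₂ (decPair sig (λ x → x) m)))))
    }

  Iso : ∀ {n p} → Rel n → Rel p → Set
  Iso A B = IsoQ 𝒱 A B

  iso-equal : ∀ {n} {A B : Rel n} → Model A → Model B → A ⊑ B → B ⊑ A → Iso A B
  iso-equal MA MB h k = id , id , (λ _ _ → h) , (λ _ _ → k) , (λ g ts → rfl′ MB _) , (λ g ts → rfl′ MA _) ,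
    rfl′ MA , rfl′ MB

  iso-refl : ∀ {n} {A : Rel n} → Model A → Iso A A
  iso-refl M = iso-equal M M id id

  iso-sym : ∀ {n p} {A : Rel n} {B : Rel p} → Iso A B → Iso B A
  iso-sym (f , g , rf , rg , hf , hg , gf , fg) = g , f , rg , rf , hg , hf , fg , gf

  iso-trans : ∀ {n p q} {A : Rel n} {B : Rel p} {C : Rel q} → Model A → Model C → Iso A B → Iso B C → Iso A C
  iso-trans MA MC (f , g , rf , rg , hf , hg , gf , fg) (f′ , g′ , rf′ , rg′ , hf′ , hg′ , gf′ , fg′) =
    f′ ∘ f , g ∘ g′ , (λ t u → rf′ _ _ ∘ rf t u) , (λ t u → rg _ _ ∘ rg′ t u) ,
    (λ o ts → trn′ MC (rf′ _ _ (hf o ts)) (hf′ o (f ∘ ts))) ,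
    (λ o ts → trn′ MA (rg _ _ (hg′ o ts)) (hg o (g′ ∘ ts))) ,
    (λ t → trn′ MA (rg _ _ (gf′ (f t))) (gf t)) ,
    (λ u → trn′ MC (rf′ _ _ (fg (g′ u))) (fg′ u))

  -- The first isomorphism theorem, with surjectivity modulo `C` given by the section `g`. That `g`
  -- is a homomorphism modulo the kernel follows, because `f` is injective there.
  pull-iso : ∀ {n p} {C : Rel p} (f : Tm n → Tm p) (g : Tm p → Tm n) → Model C → Hom 𝒱 f C →
    (∀ u → C (f (g u)) u) → Iso (pull f C) C
  pull-iso f g M hf fg = f , g , (λ _ _ → id) , (λ t u h → trn′ M (fg t) (trn′ M h (sym″ M (fg u)))) , hf ,
    (λ o ts → trn′ M (fg (op o ts)) (sym″ M (trn′ M (hf o (g ∘ ts)) (cng′ M o _ _ (fg ∘ ts))))) ,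
    (λ t → fg (f t)) , fg

  -- Equality of terms up to pointwise equality of argument families; without function
  -- extensionality, decoding reaches every term only in this sense.
  data _≈_ {n} : Rel n where
    var : ∀ x → var x ≈ var x
    op  : ∀ f {ts us} → (∀ i → ts i ≈ us i) → op f ts ≈ op f us

  ≈⇒ : ∀ {n} {θ : Rel n} → Model θ → _≈_ ⊑ θ
  ≈⇒ M (var x) = rfl′ M (var x)
  ≈⇒ M (op f h) = cng′ M f _ _ (λ i → ≈⇒ M (h i))

  enc : ∀ {n} → Tm n → ℕ
  enc (var i) = pair 0 (toℕ i)
  enc (op f ts) = pair (suc (toℕ f)) (encodeList (listOf (λ i → enc (ts i))))

  -- Arguments have smaller codes than the term they belong to, so any fuel above `enc t` is enough.
  decTermF-enc : ∀ {k} fu (t : Tm (suc k)) → enc t < fu → decTermF sig (varK k) fu (enc t) ≈ t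
  decTermF-enc {k} (suc fu) (var i) lt rewrite unpair-pair 0 (toℕ i) | varK-toℕ k i = var i
  decTermF-enc {k} (suc fu) (op f ts) (s≤s le)
    rewrite unpair-pair (suc (toℕ f)) (encodeList (listOf (λ i → enc (ts i)))) | toFin-toℕ nsym f
          | decode-encode (listOf (λ i → enc (ts i))) = op f arg
    where
    arg : ∀ i → decTermF sig (varK k) fu (nthD (listOf (λ i → enc (ts i))) (toℕ i)) ≈ ts i
    arg i rewrite nthD-listOf (λ i → enc (ts i)) i = decTermF-enc fu (ts i)
      (≤-trans (listOf-< (λ i → enc (ts i)) i) (≤-trans (snd≤ (suc (toℕ f)) _) le))

  decPair-onto : ∀ k (t u : Tm (suc k)) → Σ ℕ λ m →
    proj₁ (decPair sig (varK k) m) ≈ t × proj₂ (decPair sig (varK k) m) ≈ u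
  decPair-onto k t u = pair (enc t) (enc u) , lem
    where
    lem : proj₁ (decPair sig (varK k) (pair (enc t) (enc u))) ≈ t × proj₂ (decPair sig (varK k) (pair (enc t) (enc u))) ≈ u
    lem rewrite unpair-pair (enc t) (enc u) = decTermF-enc _ t ≤-refl , decTermF-enc _ u ≤-refl

  Coded : ∀ k → (ℕ → Set) → Rel (suc k)
  Coded k P t u = Σ ℕ λ m → P m × (decPair sig (varK k) m ≡ (t , u))

  coded-mono : ∀ {k} {P Q : ℕ → Set} → (∀ {m} → P m → Q m) → Coded k P ⊑ Coded k Q
  coded-mono h (m , p , e) = m , h p , e

  Pres : ∀ k → List ℕ → Rel (suc k)
  Pres k R = Gen 𝒱 (RelL 𝒱 k R)

  -- Consequences of the ascending chain condition

  module _ (ac : ACC 𝒱) where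

    -- The chain condition concerns congruences of a presented algebra. Without relations this
    -- algebra is free, and every model lies above its congruence.
    above-empty : ∀ {k} {θ : Rel (suc k)} → Model θ → CongAbove 𝒱 (Gen 𝒱 (RelW 𝒱 k (proj₁ emptyIndex))) θ
    above-empty M = (λ _ _ → gen-min M (λ { (m , w , _) → ⊥-elim (proj₂ emptyIndex m w) })) ,
      rfl′ M , (λ _ _ → sym″ M) , (λ _ _ _ → trn′ M) , cng′ M

    chain-stops : ∀ {k} (θ : ℕ → Rel (suc k)) → (∀ i → Model (θ i)) → (∀ i → θ i ⊑ θ (suc i)) →
      ¬ ¬ (Σ ℕ λ N → ∀ m → N ≤ m → θ m ⊑ θ N)
    chain-stops {k} θ M up κ =
      ac k (proj₁ emptyIndex) θ (λ i → above-empty (M i)) (λ i _ _ → up i) λ (N , h) → κ (N , λ m le {t} {u} → h m le t u)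

    -- The congruences generated by the relations with code below i form an ascending chain whose
    -- union is the whole congruence.
    finitely-many : ∀ k (P : ℕ → Set) → ¬ ¬ (Σ ℕ λ N → Gen 𝒱 (Coded k P) ⊑ Gen 𝒱 (Coded k (λ m → m < N × P m)))
    finitely-many k P κ =
      chain-stops (λ i → Gen 𝒱 (Coded k (λ m → m < i × P m))) (λ _ → gen-model)
         (λ i → gen-mono (coded-mono λ (lt , p) → m≤n⇒m≤1+n lt , p))
      λ (N , h) → κ (N , gen-min gen-model λ { (m , p , e) →
         h (suc m ⊔ N) (m≤n⊔m (suc m) N) (base (m , (m≤m⊔n (suc m) N , p) , e)) })

    select : ∀ (P : ℕ → Set) N → ¬ ¬ (Σ (List ℕ) λ R → (∀ m → m ∈ R → P m) × (∀ m → m < N → P m → m ∈ R))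
    select P zero k = k ([] , (λ _ ()) , λ _ ())
    select P (suc N) k = select P N λ (R , h₁ , h₂) →
      -- `P N` is not decidable. The first answer is `R`, as if `N` were outside `P`; should a proof
      -- of `P N` turn up, the answer is replaced by `N ∷ R`.
      k (R , h₁ , λ m lt p → grow R h₂ m lt p (λ q → k (N ∷ R , (λ { m (here refl) → q ; m (there i) → h₁ m i }) ,
        λ { m (s≤s le) p → choose m le (m ≟ N) h₂ p })))
      where
      choose : ∀ {R} m → m ≤ N → Dec (m ≡ N) → (∀ m → m < N → P m → m ∈ R) → P m → m ∈ N ∷ R
      choose m le (yes refl) h p = here refl
      choose m le (no n) h p = there (h m (≤∧≢⇒< le n) p)
      grow : ∀ R → (∀ m → m < N → P m → m ∈ R) → ∀ m → m < suc N → P m → ¬ P N → m ∈ R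
      grow R h m (s≤s le) p nq with m ≟ N
      ... | yes refl = ⊥-elim (nq p)
      ... | no n = h m (≤∧≢⇒< le n) p

    finite-subpresentation : ∀ k (P : ℕ → Set) →
      ¬ ¬ (Σ (List ℕ) λ R → (∀ m → m ∈ R → P m) × Gen 𝒱 (Coded k P) ⊑ Pres k R)
    finite-subpresentation k P κ = finitely-many k P λ (N , h) → select P N λ (R , h₁ , h₂) →
      κ (R , h₁ , λ {t} {u} p → gen-mono (coded-mono λ (lt , q) → h₂ _ lt q) (h p))

    -- A congruence is generated by its own pairs. Their codes form an arbitrary set `P`, not a c.e.
    -- one, and the chain condition reduces it to a finite list.
    finitely-presented : ∀ {k} {θ : Rel (suc k)} → Model θ → ¬ ¬ (Σ (List ℕ) λ R → θ ⊑ Pres k R × Pres k R ⊑ θ)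
    finitely-presented {k} {θ} M κ = finite-subpresentation k P
      λ (R , h₁ , h₂) → κ (R , (λ p → h₂ (full p)) , gen-min M (λ { (m , i , refl) → h₁ m i }))
      where
      P : ℕ → Set
      P m = θ (proj₁ (decPair sig (varK k) m)) (proj₂ (decPair sig (varK k) m))
      full : θ ⊑ Gen 𝒱 (Coded k P)
      full {t} {u} p with decPair-onto k t u
      ... | m , et , eu = trn (sym′ (≈⇒ gen-model et))
        (trn (base (m , trn′ M (≈⇒ M et) (trn′ M p (sym″ M (≈⇒ M eu))) , refl)) (≈⇒ gen-model eu))

    power : ∀ {n} → (Tm n → Tm n) → ℕ → Tm n → Tm n
    power φ zero t = t
    power φ (suc i) t = φ (power φ i t)

    -- The kernels of the powers of `φ` ascend; let them stop at N. Since `φ` is onto, `t` and `u`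
    -- are the images of some t′ and u′ under the N-th power. If `φ` identifies `t` and `u`, the
    -- next power identifies t′ and u′, hence so does the N-th.
    hopfian : ∀ {k} {C : Rel (suc k)} → Model C → (φ ψ : Tm (suc k) → Tm (suc k)) → Hom 𝒱 φ C → Resp 𝒱 φ C C →
      (∀ u → C (φ (ψ u)) u) → ∀ {t u} → C (φ t) (φ u) → ¬ ¬ C t u
    hopfian {k} {C} M φ ψ hφ rφ φψ {t} {u} p κ =
      chain-stops (λ i → pull (power φ i) C) (λ i → pull-model (power φ i) M (power-hom i)) (λ i → rφ _ _)
      λ (N , h) → κ (trn′ M (sym″ M (section N t)) (trn′ M
         (h (suc N) (n≤1+n N) (trn′ M (rφ _ _ (section N t)) (trn′ M p (sym″ M (rφ _ _ (section N u))))))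
         (section N u)))
      where
      power-hom : ∀ i → Hom 𝒱 (power φ i) C
      power-hom zero f ts = rfl′ M _
      power-hom (suc i) f ts = trn′ M (rφ _ _ (power-hom i f ts)) (hφ f _)
      pre : ℕ → Tm (suc k) → Tm (suc k)
      pre zero t = t
      pre (suc i) t = pre i (ψ t)
      section : ∀ i t → C (power φ i (pre i t)) t
      section zero t = rfl′ M t
      section (suc i) t = trn′ M (rφ _ _ (section i (ψ t))) (φψ t)

  -- Free algebras and an additional generator

  Free : ∀ n → Rel n
  Free n = Gen 𝒱 (λ _ _ → ⊥)

  free-least : ∀ {n} {θ : Rel n} → Model θ → Free n ⊑ θ
  free-least M = gen-min M λ ()

  sub-hom : ∀ {n p} {C : Rel p} → Model C → (s : Fin n → Tm p) → Hom 𝒱 (sub sig s) C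
  sub-hom M s f ts = rfl′ M _

  free-sub : ∀ {n p} {C : Rel p} → Model C → (s : Fin n → Tm p) → Free n ⊑ pull (sub sig s) C
  free-sub M s = free-least (pull-model (sub sig s) M (sub-hom M s))

  -- An identity between two distinct variables can be instantiated to any two terms.
  trivial : ∀ {n p} → Free (suc (suc n)) (var F.zero) (var (F.suc F.zero)) → {C : Rel p} → Model C → ∀ t u → C t u
  trivial p M t u = free-sub M (λ { F.zero → t ; (F.suc _) → u }) p

  total-iso : ∀ {n p} {A : Rel (suc n)} {B : Rel (suc p)} → (∀ t u → A t u) → (∀ t u → B t u) → Iso A B
  total-iso a b = (λ _ → var F.zero) , (λ _ → var F.zero) , (λ _ _ _ → b _ _) , (λ _ _ _ → a _ _) ,
    (λ _ _ → b _ _) , (λ _ _ → a _ _) , (λ _ → a _ _) , (λ _ → b _ _)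

  -- An algebra on suc k generators, presented on one generator more by doubling the first one.
  merge : ∀ {n} → Fin (suc (suc n)) → Fin (suc n)
  merge F.zero = F.zero
  merge (F.suc i) = i

  fold : ∀ {k} → Tm (suc (suc k)) → Tm (suc k)
  fold = sub sig (λ x → var (merge x))

  unfold : ∀ {k} → Tm (suc k) → Tm (suc (suc k))
  unfold = sub sig (λ x → var (F.suc x))

  fold-unfold : ∀ {k} (t : Tm (suc k)) → fold (unfold t) ≈ t
  fold-unfold (var x) = var x
  fold-unfold (op f ts) = op f (λ i → fold-unfold (ts i))

  doubled : ∀ {k} → Rel (suc k) → Rel (suc (suc k))
  doubled = pull fold

  doubled-model : ∀ {k} {A : Rel (suc k)} → Model A → Model (doubled A)
  doubled-model M = pull-model fold M (sub-hom M (λ x → var (merge x)))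

  doubled-iso : ∀ {k} {A : Rel (suc k)} → Model A → Iso (doubled A) A
  doubled-iso M = pull-iso fold unfold M (sub-hom M (λ x → var (merge x))) (λ t → ≈⇒ M (fold-unfold t))

  -- `g` induces a surjective endomorphism of the free algebra, which is injective by `hopfian`. But
  -- it factors through `doubled A`, where the first two generators coincide.
  free≇doubled : ACC 𝒱 → ∀ {k} {A : Rel (suc k)} → Model A → Iso (Free (suc (suc k))) (doubled A) →
    ¬ ¬ (Free (suc (suc k)) (var F.zero) (var (F.suc F.zero)))
  free≇doubled ac {k} M (f , g , rf , rg , hf , hg , gf , fg) =
    hopfian ac gen-model g f hg (λ _ _ → rg _ _ ∘ free-least (doubled-model M)) gf (rg _ _ (rfl′ M _))

-- Ordinals below ω^ω

data _<L_ : List ℕ → List ℕ → Set where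
  nil  : ∀ {y ys} → [] <L (y ∷ ys)
  head : ∀ {x y xs ys} → x < y → (x ∷ xs) <L (y ∷ ys)
  tail : ∀ {x xs ys} → xs <L ys → (x ∷ xs) <L (x ∷ ys)

T⇒≡true : ∀ {b} → T b → b ≡ true
T⇒≡true {true} _ = refl

<L⇒ltL : ∀ {xs ys} → xs <L ys → T (ltL xs ys)
<L⇒ltL nil = tt
<L⇒ltL (head {x} {y} lt) rewrite T⇒≡true (<⇒<ᵇ lt) = tt
<L⇒ltL (tail {x} h) with x <ᵇ x
... | true = tt
... | false rewrite ≡ᵇ-refl x = <L⇒ltL h

ltL⇒<L : ∀ xs ys → T (ltL xs ys) → xs <L ys
ltL⇒<L [] (y ∷ ys) _ = nil
ltL⇒<L (x ∷ xs) (y ∷ ys) t with x <ᵇ y in lt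
... | true = head (<ᵇ⇒< x y (subst T (sym lt) tt))
... | false with x ≡ᵇ y in eq
... | true with ≡ᵇ⇒≡ x y (subst T (sym eq) tt)
... | refl = tail (ltL⇒<L xs ys t)

<L-trans : ∀ {xs ys zs} → xs <L ys → ys <L zs → xs <L zs
<L-trans nil (head _) = nil
<L-trans nil (tail _) = nil
<L-trans (head p) (head q) = head (<-trans p q)
<L-trans (head p) (tail q) = head p
<L-trans (tail p) (head q) = head q
<L-trans (tail p) (tail q) = tail (<L-trans p q)

<L-irrefl : ∀ {xs} → ¬ xs <L xs
<L-irrefl (head p) = <-irrefl refl p
<L-irrefl (tail p) = <L-irrefl p

-- The lexicographic order on arbitrary lists is not well-founded, so the smaller list is required
-- to be a Cantor normal form.
_≺_ : List ℕ → List ℕ → Set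
β ≺ γ = NonInc β × β <L γ

-- For a normal form this means being below ω^b.
Headed : ℕ → List ℕ → Set
Headed b [] = ⊤
Headed b (x ∷ xs) = x < b

tail-NonInc : ∀ {x xs} → NonInc (x ∷ xs) → NonInc xs
tail-NonInc (one _) = nil
tail-NonInc (cons _ n) = n

tail-Headed : ∀ {x xs} → NonInc (x ∷ xs) → Headed (suc x) xs
tail-Headed (one _) = tt
tail-Headed (cons y≤x _) = s≤s y≤x

acc-[] : Acc _≺_ []
acc-[] = acc λ { (_ , ()) }

-- An ordinal below ω^x + ξ is either below ω^x, where `H` applies, or of the form ω^x + η with η <
-- ξ, which is reached by recursion on the accessibility of ξ.
acc-∷ : ∀ {x xs} → (∀ β → NonInc β → Headed x β → Acc _≺_ β) → NonInc (x ∷ xs) → Acc _≺_ xs → Acc _≺_ (x ∷ xs)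
acc-∷ {x} H n (acc rs) = acc λ
  { {[]} _ → acc-[]
  ; {y ∷ ys} (m , head y<x) → H (y ∷ ys) m y<x
  ; {y ∷ ys} (m , tail lt) → acc-∷ H m (rs (tail-NonInc m , lt)) }

-- A normal form below ω^(b+1) either is below ω^b or begins with the exponent `b`. In the latter
-- case its tail is again below ω^(b+1), and shorter.
acc-step : ∀ {b} → (∀ β → NonInc β → Headed b β → Acc _≺_ β) → ∀ β → NonInc β → Headed (suc b) β → Acc _≺_ β
acc-step H [] _ _ = acc-[]
acc-step H (x ∷ xs) n (s≤s x≤b) with m≤n⇒m<n∨m≡n x≤b
... | inj₁ x<b = H (x ∷ xs) n x<b
... | inj₂ refl = acc-∷ H n (acc-step H xs (tail-NonInc n) (tail-Headed n))

acc-headed : ∀ b β → NonInc β → Headed b β → Acc _≺_ β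
acc-headed b [] _ _ = acc-[]
acc-headed (suc b) (x ∷ xs) = acc-step (acc-headed b) (x ∷ xs)

≺-wellFounded : ∀ β → NonInc β → Acc _≺_ β
≺-wellFounded [] _ = acc-[]
≺-wellFounded β@(x ∷ xs) n = acc-headed (suc x) β n ≤-refl

Below : OrdLe → List ℕ → Set
Below α β = NonInc β × T (belowB β α)

below-≤O : ∀ {α λ′ β} → α ≤O λ′ → Below α β → Below λ′ β
below-≤O {cnf γ _} {cnf δ _} {β} (inj₁ lt) (n , b) = n , <L⇒ltL (<L-trans (ltL⇒<L β γ b) (ltL⇒<L γ δ lt))
below-≤O {cnf γ _} {cnf .γ _} (inj₂ refl) b = b
below-≤O {cnf γ _} {ωω} _ (n , _) = n , tt
below-≤O {ωω} {ωω} _ b = b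

zero-below : ∀ {α} → omega ≤O α → Below α []
zero-below {cnf (x ∷ xs) _} _ = nil , tt
zero-below {cnf [] _} (inj₁ ())
zero-below {cnf [] _} (inj₂ ())
zero-below {ωω} _ = nil , tt

cnt-mono : ∀ α {M N} → M ≤ N → cnt α M ≤ cnt α N
cnt-mono α {M} {zero} z≤n = ≤-refl
cnt-mono α {M} {suc N} le with m≤n⇒m<n∨m≡n le
... | inj₁ (s≤s lt) = ≤-trans (cnt-mono α lt) (m≤n+m (cnt α N) (if belowB (ordDecode N) α then 1 else 0))
... | inj₂ refl = ≤-refl

cnt-suc : ∀ α N → T (belowB (ordDecode N) α) → cnt α N < cnt α (suc N)
cnt-suc α N b with belowB (ordDecode N) α
... | true = ≤-refl

hα-< : ∀ {α β γ} → Below α β → ordCode β < ordCode γ → hα α β < hα α γ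
hα-< {α} {β} (n , b) lt = ≤-trans
  (cnt-suc α (ordCode β) (subst (λ z → T (belowB z α)) (sym (ordDecode-ordCode n)) b)) (cnt-mono α lt)

-- `cnt α` grows strictly at every code of an ordinal below `α`.
hα-injective : ∀ {α β γ} → Below α β → Below α γ → hα α β ≡ hα α γ → β ≡ γ
hα-injective {α} {β} {γ} b c e with <-cmp (ordCode β) (ordCode γ)
... | tri< lt _ _ = ⊥-elim (<-irrefl e (hα-< {γ = γ} b lt))
... | tri≈ _ eq _ = trans (sym (ordDecode-ordCode (proj₁ b))) (trans (cong ordDecode eq) (ordDecode-ordCode (proj₁ c)))
... | tri> _ _ gt = ⊥-elim (<-irrefl (sym e) (hα-< {γ = β} c gt))

code≤⇒ : ∀ {α β γ} → Below α β → Below α γ → hα α β ≤[ α ] hα α γ → β <L γ ⊎ β ≡ γ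
code≤⇒ {α} {β} {γ} b c (β′ , γ′ , n , n′ , t , t′ , e , e′ , o)
  with hα-injective (n , t) b e | hα-injective (n′ , t′) c e′
code≤⇒ _ _ (β , γ , _ , _ , _ , _ , _ , _ , inj₁ lt) | refl | refl = inj₁ (ltL⇒<L β γ lt)
code≤⇒ _ _ (β , γ , _ , _ , _ , _ , _ , _ , inj₂ eq) | refl | refl = inj₂ eq

⇒code≤ : ∀ {α β γ} → Below α β → Below α γ → β <L γ ⊎ β ≡ γ → hα α β ≤[ α ] hα α γ
⇒code≤ {β = β} {γ} (n , b) (m , c) (inj₁ lt) = β , γ , n , m , b , c , refl , refl , inj₁ (<L⇒ltL lt)
⇒code≤ {β = β} {γ} (n , b) (m , c) (inj₂ eq) = β , γ , n , m , b , c , refl , refl , inj₂ eq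

-- Programs that wait for an event

memN : List ℕ → ℕ → ℕ
memN [] x = 1
memN (a ∷ l) x = diff x a * memN l x

memF : ∀ l → Comp 1 (F1 (memN l))
memF [] = def1 (konst 1) λ _ → refl
memF (a ∷ l) = def1 (app2 mulF (app2 diffF (var #0) (konst a)) (app1 (memF l) (var #0))) λ _ → refl

memN-sound : ∀ l x → memN l x ≡ 0 → x ∈ l
memN-sound (a ∷ l) x e with m*n≡0⇒m≡0∨n≡0 (diff x a) e
... | inj₁ d = here (diff≡0 x a d)
... | inj₂ m = there (memN-sound l x m)

memN-complete : ∀ l x → x ∈ l → memN l x ≡ 0
memN-complete (a ∷ l) x (here refl) rewrite diff-refl x = refl
memN-complete (a ∷ l) x (there i) rewrite memN-complete l x i = *-zeroʳ (diff x a)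

-- The event is a property of the index `e`, so a program can wait for something that happens to its
-- own set.
record Waiting (A B : List ℕ) (E : ℕ → Set) (e : ℕ) : Set where
  field
    sound : ∀ {x} → W e x → x ∈ A ⊎ (x ∈ B × E e)
    now   : ∀ {x} → x ∈ A → W e x
    later : E e → ∀ {x} → x ∈ B → W e x

  unfired : ¬ E e → ∀ {x} → W e x → x ∈ A
  unfired h w with sound w
  ... | inj₁ a = a
  ... | inj₂ (_ , f) = ⊥-elim (h f)

-- With 0 for truth, a product is a disjunction and a sum a conjunction. The recursion theorem
-- supplies the index `e` that `Φ` is asked about.
wait : ∀ A B {Φ} {E : ℕ → Set} → Comp 2 (F2 Φ) → (∀ e t → Φ e t ≡ 0 → E e) → (∀ e → E e → ∃ λ t → Φ e t ≡ 0) →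
  Σ ℕ λ e → Waiting A B E e
wait A B {Φ} {E} c snd′ cpl with recursion {F3 λ e x s → memN A x * (memN B x + Φ e s)}
    (def3 (app2 mulF (app1 (memF A) (var #1)) (app2 addF (app1 (memF B) (var #1)) (app2 c (var #0) (var #2)))) λ _ _ _ → refl)
... | e , p = e , record
  { sound = λ {x} w → sound x (proj₁ (p x) w)
  ; now = λ {x} i → proj₂ (p x) 0 (cong (_* (memN B x + Φ e 0)) (memN-complete A x i))
  ; later = λ f {x} i → let (t , h) = cpl e f in
      proj₂ (p x) t (trans (cong (memN A x *_) (cong₂ _+_ (memN-complete B x i) h)) (*-zeroʳ (memN A x)))
  }
  where
  sound : ∀ x → (Σ ℕ λ s → memN A x * (memN B x + Φ e s) ≡ 0) → x ∈ A ⊎ (x ∈ B × E e)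
  sound x (s , h) with m*n≡0⇒m≡0∨n≡0 (memN A x) h
  ... | inj₁ a = inj₁ (memN-sound A x a)
  ... | inj₂ b = inj₂ (memN-sound B x (m+n≡0⇒m≡0 (memN B x) b) , snd′ e s (m+n≡0⇒n≡0 (memN B x) b))

finite-index : ∀ A → Σ ℕ λ e → (∀ {x} → W e x → x ∈ A) × (∀ {x} → x ∈ A → W e x)
finite-index A with wait A [] {λ _ _ → 1} {λ _ → ⊥} (def2 (konst 1) λ _ _ → refl) (λ _ _ ()) (λ _ ())
... | e , w = e , Waiting.unfired w id , Waiting.now w

suc≢0 : ∀ {n} → suc n ≢ 0
suc≢0 ()

-- The event is that `c` enters the set whose index `p` computes from `e`.
module Member (p c : ℕ) where

  Φ : ℕ → ℕ → ℕ
  Φ e t = ifz (simOut p e t) 1 (ifz (simOut (pred (simOut p e t)) c t) 1 0)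

  ΦF : Comp 2 (F2 Φ)
  ΦF = def2 (app3 ifzF q (konst 1) (app3 ifzF (app3 simF (app1 predF q) (konst c) (var #1)) (konst 1) ze)) λ _ _ → refl
    where
    q : Comp 2 (λ ρ → simOut p (V.lookup ρ #0) (V.lookup ρ #1))
    q = app3 simF (konst p) (var #0) (var #1)

  sound : ∀ e t → Φ e t ≡ 0 → ∃ λ y → Out p e y × W y c
  sound e t h with simOut p e t in eq
  ... | suc y with simOut y c t in eq′
  ... | suc z = y , sim-out p e t eq , z , sim-out y c t eq′

  complete : ∀ e y → Out p e y → W y c → ∃ λ t → Φ e t ≡ 0
  complete e y o (z , w) with out-sim p e o | out-sim y c w
  ... | s , h | s′ , h′ = s ⊔ s′ , lem
    where
    lem : Φ e (s ⊔ s′) ≡ 0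
    lem rewrite sim-mono (m≤m⊔n s s′) h | sim-mono (m≤n⊔m s s′) h′ = refl

  waiting : ∀ A B → Σ ℕ λ e → Waiting A B (λ e → ∃ λ y → Out p e y × W y c) e
  waiting A B = wait A B ΦF sound (λ e (y , o , w) → complete e y o w)

-- Finite stages of a presentation

stage : ℕ → ℕ → ℕ → List ℕ
stage i u zero = []
stage i u (suc m) with simOut i m u
... | zero = stage i u m
... | suc _ = m ∷ stage i u m

stageN : ℕ → ℕ → ℕ
stageN i u = natrec 0 (λ m r → ifz (simOut i m u) r (m ∷ᶜ r)) u

stageF : Comp 2 (F2 stageN)
stageF = def2 (rec ze (app3 ifzF (app3 simF (var #2) (var #1) (var #3)) (var #0) (app2 consF (var #1) (var #0))) (var #1)) λ _ _ → refl

stageN≡ : ∀ i u → stageN i u ≡ encodeList (stage i u u)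
stageN≡ i u = go u
  where
  go : ∀ n → natrec 0 (λ m r → ifz (simOut i m u) r (m ∷ᶜ r)) n ≡ encodeList (stage i u n)
  go zero = refl
  go (suc m) with simOut i m u
  ... | zero = go m
  ... | suc _ = trans (cong (m ∷ᶜ_) (go m)) (sym (encodeList-∷ m (stage i u m)))

stage-W : ∀ i u n {m} → m ∈ stage i u n → W i m
stage-W i u (suc n) h with simOut i n u in eq
stage-W i u (suc n) h | zero = stage-W i u n h
stage-W i u (suc n) (here refl) | suc y = y , sim-out i n u eq
stage-W i u (suc n) (there h) | suc y = stage-W i u n h

stage-∈ : ∀ i u n {m y} → m < n → simOut i m u ≡ suc y → m ∈ stage i u n
stage-∈ i u (suc n) {m} (s≤s le) e with m≤n⇒m<n∨m≡n le | simOut i n u in eq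
... | inj₁ lt | zero = stage-∈ i u n lt e
... | inj₁ lt | suc _ = there (stage-∈ i u n lt e)
... | inj₂ refl | zero = ⊥-elim (suc≢0 (trans (sym e) eq))
... | inj₂ refl | suc _ = here refl

stage-covers : ∀ i R → (∀ m → m ∈ R → W i m) → ∃ λ u → ∀ m → m ∈ R → m ∈ stage i u u
stage-covers i R h = proj₁ (go R h) , λ m r → let (lt , y , e) = proj₂ (go R h) m r in stage-∈ i _ _ lt e
  where
  go : ∀ R → (∀ m → m ∈ R → W i m) → ∃ λ u → ∀ m → m ∈ R → m < u × ∃ λ y → simOut i m u ≡ suc y
  go [] h = 0 , λ _ ()
  go (a ∷ R) h with go R (λ m r → h m (there r)) | out-sim i a (proj₂ (h a (here refl)))
  ... | u , k | s , e = u ⊔ (suc a ⊔ s) , λ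
    { m (here refl) → ≤-trans (m≤m⊔n (suc m) s) (m≤n⊔m u _) , _ , sim-mono (≤-trans (m≤n⊔m (suc m) s) (m≤n⊔m u _)) e
    ; m (there r) → let (lt , y , e′) = k m r in ≤-trans lt (m≤m⊔n u _) , y , sim-mono (m≤m⊔n u _) e′ }

query : ℕ → ℕ → ℕ → ℕ → ℕ
query k r j s = pair k (pair j (pair r s))

-- The program d answers 0 to the query whether a stage of the presentation with index p(e)
-- presents the same algebra as the relations coded by s on suc j generators.
Answered : (p d j s e : ℕ) → Set
Answered p d j s e = ∃ λ z → ∃ λ u → Out p e z × Out d (query (pred (fst z)) (encodeList (stage (snd z) u u)) j s) 0

module Decide (p d j s : ℕ) where

  Φ′ : ℕ → ℕ → ℕ → ℕ
  -- `simOut` shifts outputs by one, so the value 1 stands for the answer 0, that is, for an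
  -- isomorphism.
  Φ′ z u v = diff (simOut d (query (pred (fst z)) (stageN (snd z) u) j s) v) 1

  -- `t` codes a stage together with the number of steps granted to both `p` and `d`.
  Φ : ℕ → ℕ → ℕ
  Φ e t = ifz (simOut p e (snd t)) 1 (Φ′ (pred (simOut p e (snd t))) (fst t) (snd t))

  Φ′F : Comp 3 (F3 Φ′)
  Φ′F = def3 (app2 diffF (app3 simF (konst d) (app2 pairF (app1 predF (app1 fstF (var #0)))
      (app2 pairF (konst j) (app2 pairF (app2 stageF (app1 sndF (var #0)) (var #1)) (konst s)))) (var #2)) (konst 1)) λ _ _ _ → refl

  ΦF : Comp 2 (F2 Φ)
  ΦF = def2 (app3 ifzF q (konst 1) (app3 Φ′F (app1 predF q) (app1 fstF (var #1)) (app1 sndF (var #1)))) λ _ _ → refl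
    where
    q : Comp 2 (λ ρ → simOut p (V.lookup ρ #0) (snd (V.lookup ρ #1)))
    q = app3 simF (konst p) (var #0) (app1 sndF (var #1))

  sound : ∀ e t → Φ e t ≡ 0 → Answered p d j s e
  sound e t h with simOut p e (snd t) in eq
  ... | suc z = z , fst t , sim-out p e (snd t) eq ,
    subst (λ r → Out d (query (pred (fst z)) r j s) 0) (stageN≡ (snd z) (fst t)) (sim-out d _ (snd t) (diff≡0 _ 1 h))

  complete : ∀ e z u → Out p e z → Out d (query (pred (fst z)) (encodeList (stage (snd z) u u)) j s) 0 → ∃ λ t → Φ e t ≡ 0
  complete e z u o o′
    with out-sim p e o | out-sim d (query (pred (fst z)) (stageN (snd z) u) j s)
           (subst (λ r → Out d (query (pred (fst z)) r j s) 0) (sym (stageN≡ (snd z) u)) o′)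
  ... | v , h | v′ , h′ = pair u (v ⊔ v′) , lem
    where
    lem : Φ e (pair u (v ⊔ v′)) ≡ 0
    lem rewrite snd-pair u (v ⊔ v′) | fst-pair u (v ⊔ v′) | sim-mono (m≤m⊔n v v′) h | sim-mono (m≤n⊔m v v′) h′ = refl

  waiting : ∀ A B → Σ ℕ λ e → Waiting A B (Answered p d j s) e
  waiting A B = wait A B ΦF sound (λ e (z , u , o , o′) → complete e z u o o′)

-- Levels

Level : Set
Level = Maybe (List ℕ)

AtLevel : OrdLe → Level → ℕ → Set
AtLevel α nothing e = ∀ x → ¬ W e x
AtLevel α (just β) e = Below α β × IsLeast α (W e) (hα α β)

_<ℓ_ : List ℕ → Level → Set
γ <ℓ nothing = ⊤
γ <ℓ just β = γ <L β

-- Reflexivity at `e` already contains either the emptiness of `W e` or its least element, so that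
-- no excluded middle is called for.
level-of : ∀ {α e} → Emin α e e → ∃ λ ℓ → AtLevel α ℓ e
level-of (inj₁ (h , _)) = nothing , h
level-of (inj₂ (x , l@(w , h) , _)) with h x w
... | β , _ , n , _ , b , _ , refl , _ = just β , (n , b) , l

least-unique : ∀ {α P Q x β} → IsLeast α P x → IsLeast α Q x → Below α β → IsLeast α P (hα α β) → x ≡ hα α β
least-unique {α} {β = β} (p , h) _ b (p′ , h′) with h _ p′ | h′ _ p
... | β₁ , γ₁ , n₁ , n₁′ , b₁ , b₁′ , refl , e₁ , o | q with hα-injective {α} (n₁′ , b₁′) b e₁
... | refl with o | code≤⇒ {α} b (n₁ , b₁) q
... | inj₂ refl | _ = refl
... | inj₁ _ | inj₂ refl = refl
... | inj₁ lt | inj₁ lt′ = ⊥-elim (<L-irrefl (<L-trans (ltL⇒<L β₁ β lt) lt′))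

same-level : ∀ {α} ℓ {e i} → AtLevel α ℓ e → AtLevel α ℓ i → Emin α e i
same-level nothing h k = inj₁ (h , k)
same-level {α} (just β) (_ , h) (_ , k) = inj₂ (hα α β , h , k)

levels-differ : ∀ {α} ℓ {γ e i} → γ <ℓ ℓ → AtLevel α ℓ e → AtLevel α (just γ) i → ¬ Emin α e i
levels-differ ℓ lt h (_ , w , _) (inj₁ (_ , h′)) = h′ _ w
levels-differ nothing lt h _ (inj₂ (x , (w , _) , _)) = h x w
levels-differ {α} (just β) {γ} lt (b , h) (c , k) (inj₂ (x , l , l′))
  with hα-injective {α} b c (trans (sym (least-unique {α} l l b h)) (least-unique {α} l′ l′ c k))
... | refl = <L-irrefl lt

module Main (𝒱 : Variety) (ac : ACC 𝒱) where
  open Algebra 𝒱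
  open Model

  -- Levels of the congruences on a fixed number of generators

  module Levels (k : ℕ) (α : OrdLe) (red : VnIso 𝒱 (suc k) ≤c Emin α) where

    gp : ℕ
    gp = proj₁ red

    g : ℕ → ℕ
    g j = proj₁ (proj₁ (proj₂ red) j)

    g-out : ∀ j → Out gp j (g j)
    g-out j = proj₂ (proj₁ (proj₂ red) j)

    ⟦_⟧ : ℕ → Rel (suc k)
    ⟦ j ⟧ = Gen 𝒱 (RelW 𝒱 k j)

    iso⇒emin : ∀ {i j} → Iso ⟦ i ⟧ ⟦ j ⟧ → Emin α (g i) (g j)
    iso⇒emin {i} {j} = proj₁ (proj₂ (proj₂ red) i j (g i) (g j) (g-out i) (g-out j))

    emin⇒iso : ∀ {i j} → Emin α (g i) (g j) → Iso ⟦ i ⟧ ⟦ j ⟧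
    emin⇒iso {i} {j} = proj₂ (proj₂ (proj₂ red) i j (g i) (g j) (g-out i) (g-out j))

    record _HasLevel_ (θ : Rel (suc k)) (ℓ : Level) : Set where
      constructor hasLevel
      field
        index : ℕ
        up    : θ ⊑ ⟦ index ⟧
        down  : ⟦ index ⟧ ⊑ θ
        level : AtLevel α ℓ (g index)

    has-level : ∀ {θ} → Model θ → ¬ ¬ (∃ λ ℓ → θ HasLevel ℓ)
    has-level M κ = finitely-presented ac M λ (R , up , down) →
      let (j , snd′ , cpl) = finite-index R
          (ℓ , lvl) = level-of {α} {g j} (iso⇒emin {j} {j} (iso-refl gen-model))
      in κ (ℓ , hasLevel j (λ p → gen-mono (coded-mono cpl) (up p)) (λ p → down (gen-mono (coded-mono snd′) p)) lvl)

    equal-level : ∀ {θ θ′} ℓ → Model θ → Model θ′ → θ HasLevel ℓ → θ′ HasLevel ℓ → Iso θ θ′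
    equal-level {θ} {θ′} ℓ M M′ (hasLevel i u d lvl) (hasLevel j u′ d′ lvl′) =
      iso-trans M M′ (iso-equal M gen-model u d)
        (iso-trans gen-model M′ (emin⇒iso (same-level ℓ lvl lvl′)) (iso-equal gen-model M′ d′ u′))

    -- At level ⊤, a second congruence of the same level would have an isomorphic quotient. At level
    -- β, let `e` present `θ` by `R` until `hα α β` enters `W (g e)`, and then add `R′`. If this
    -- never happened, `e` would present `θ` and `g e` would have level β after all. Once it has
    -- happened, `e` presents `θ′`, and its level is at most β because `hα α β` was enumerated;
    -- equality would again give an isomorphism.
    smaller : ∀ ℓ {θ θ′} → Model θ → Model θ′ → θ ⊑ θ′ → ¬ Iso θ θ′ → θ HasLevel ℓ →
      ¬ ¬ (∃ λ γ → Below α γ × γ <ℓ ℓ × θ′ HasLevel (just γ))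
    smaller nothing M M′ sub ¬iso lvl κ = has-level M′ λ
      { (nothing , lvl′) → ¬iso (equal-level nothing M M′ lvl lvl′)
      ; (just γ , lvl′) → κ (γ , proj₁ (_HasLevel_.level lvl′) , tt , lvl′) }
    smaller (just β) {θ} {θ′} M M′ θ⊑θ′ ¬iso lvl@(hasLevel j u d lev@(b , least@(w , _))) κ =
      finitely-presented ac M λ (R , up , down) →
      finitely-presented ac M′ λ (R′ , up′ , down′) →
      go R R′ up down up′ down′ (Member.waiting gp (hα α β) R R′)
      where
      Fired : ℕ → Set
      Fired e = ∃ λ y → Out gp e y × W y (hα α β)
      go : ∀ R R′ → θ ⊑ Pres k R → Pres k R ⊑ θ → θ′ ⊑ Pres k R′ → Pres k R′ ⊑ θ′ → (Σ ℕ λ e → Waiting R R′ Fired e) → ⊥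
      go R R′ up down up′ down′ (e , wt) = waits λ f → fired f (level-of {α} {g e} (iso⇒emin {e} {e} (iso-refl gen-model)))
        where
        open Waiting wt
        waits : ¬ ¬ Fired e
        waits h = absurd (iso⇒emin {e} {j} (iso-equal gen-model gen-model
            (λ p → u (down (gen-mono (coded-mono (unfired h)) p)))
            (λ p → gen-mono (coded-mono now) (up (d p)))))
          where
          absurd : ¬ Emin α (g e) (g j)
          absurd (inj₁ (_ , ¬w)) = ¬w _ w
          absurd (inj₂ (x , l , l′)) = h (g e , g-out e , subst (W (g e)) (least-unique {α} l′ l′ b least) (proj₁ l))
        fired : Fired e → (∃ λ ℓ → AtLevel α ℓ (g e)) → ⊥
        fired f@(y , o , wy) = conclude
          where
          wg : W (g e) (hα α β)
          wg = subst (λ i → W i (hα α β)) (out-unique gp e o (g-out e)) wy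
          upₑ : θ′ ⊑ ⟦ e ⟧
          upₑ p = gen-mono (coded-mono (later f)) (up′ p)
          relation : ∀ m {t u} → decPair (Variety.sig 𝒱) (varK k) m ≡ (t , u) → m ∈ R ⊎ (m ∈ R′ × Fired e) → θ′ t u
          relation m eq (inj₁ r) = θ⊑θ′ (down (base (m , r , eq)))
          relation m eq (inj₂ (r , _)) = down′ (base (m , r , eq))
          downₑ : ⟦ e ⟧ ⊑ θ′
          downₑ = gen-min M′ λ { (m , w , eq) → relation m eq (sound w) }
          conclude : (∃ λ ℓ → AtLevel α ℓ (g e)) → ⊥
          conclude (nothing , empty) = empty _ wg
          conclude (just γ , lev′@(c , _ , h)) with code≤⇒ {α} c b (h _ wg)
          ... | inj₁ lt = κ (γ , c , lt , hasLevel e upₑ downₑ lev′)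
          ... | inj₂ refl = ¬iso (equal-level (just γ) M M′ lvl (hasLevel e upₑ downₑ lev′))

  -- Quotients obtained from a reduction of `Emin λ′`

  module Reduction (dfp : DecFP 𝒱) (λ′ : OrdLe) (red : Emin λ′ ≤c VfgIso 𝒱) where

    p : ℕ
    p = proj₁ red

    H : ℕ → ℕ
    H e = proj₁ (proj₁ (proj₂ red) e)

    H-out : ∀ e → Out p e (H e)
    H-out e = proj₂ (proj₁ (proj₂ red) e)

    K I : ℕ → ℕ
    K x = pred (fst x)
    I x = snd x

    Alg : (x : ℕ) → Rel (suc (K x))
    Alg x = Gen 𝒱 (RelW 𝒱 (K x) (I x))

    vfg : ∀ x y → VfgIso 𝒱 x y ≡ Iso (Alg x) (Alg y)
    vfg x y rewrite fst≡ x | snd≡ x | fst≡ y | snd≡ y = refl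

    emin⇒iso : ∀ {i j} → Emin λ′ i j → Iso (Alg (H i)) (Alg (H j))
    emin⇒iso {i} {j} h = subst id (vfg (H i) (H j)) (proj₁ (proj₂ (proj₂ red) i j (H i) (H j) (H-out i) (H-out j)) h)

    iso⇒emin : ∀ {i j} → Iso (Alg (H i)) (Alg (H j)) → Emin λ′ i j
    iso⇒emin {i} {j} h = proj₂ (proj₂ (proj₂ red) i j (H i) (H j) (H-out i) (H-out j)) (subst id (sym (vfg (H i) (H j))) h)

    record _Realizes_ {m} (θ : Rel (suc m)) (ℓ : Level) : Set where
      constructor realizes
      field
        index : ℕ
        level : AtLevel λ′ ℓ index
        iso   : Iso (Alg (H index)) θ

    d : ℕ
    d = proj₁ dfp

    decides : ∀ k j R S → Iso (Pres k R) (Pres j S) → Out d (query k (encodeList R) j (encodeList S)) 0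
    decides k j R S iso with proj₂ dfp k j R S
    ... | inj₁ (o , _) = o
    ... | inj₂ (_ , ¬iso) = ⊥-elim (¬iso iso)

    decided : ∀ k j R S → Out d (query k (encodeList R) j (encodeList S)) 0 → Iso (Pres k R) (Pres j S)
    decided k j R S o with proj₂ dfp k j R S
    ... | inj₁ (_ , iso) = iso
    ... | inj₂ (o′ , _) with out-unique d (query k (encodeList R) j (encodeList S)) o o′
    ... | ()

    codes : Level → List ℕ
    codes nothing = []
    codes (just β) = hα λ′ β ∷ []

    level-codes : ∀ ℓ {e i} → AtLevel λ′ ℓ i → (∀ {x} → W e x → x ∈ codes ℓ) → (∀ {x} → x ∈ codes ℓ → W e x) → AtLevel λ′ ℓ e
    level-codes nothing _ h k x w with h w
    ... | ()
    level-codes (just β) (b , _) h k = b , k (here refl) , λ y w → least y (h w)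
      where
      least : ∀ y → y ∈ codes (just β) → hα λ′ β ≤[ λ′ ] y
      least y (here refl) = ⇒code≤ {λ′} b b (inj₂ refl)

    level-drop : ∀ ℓ {γ e i} → AtLevel λ′ ℓ i → Below λ′ γ → γ <ℓ ℓ → (∀ {x} → W e x → x ∈ codes ℓ ⊎ x ∈ codes (just γ)) →
      W e (hα λ′ γ) → AtLevel λ′ (just γ) e
    level-drop ℓ {γ} lvl c lt h w = c , w , λ y w′ → least ℓ lvl lt y (h w′)
      where
      least : ∀ ℓ {i} → AtLevel λ′ ℓ i → γ <ℓ ℓ → ∀ y → y ∈ codes ℓ ⊎ y ∈ codes (just γ) → hα λ′ γ ≤[ λ′ ] y
      least ℓ lvl lt y (inj₂ (here refl)) = ⇒code≤ {λ′} c c (inj₂ refl)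
      least (just β) (b , _) lt y (inj₁ (here refl)) = ⇒code≤ {λ′} c b (inj₁ lt)

    -- Let `e` have level `ℓ` until some stage of the algebra assigned to it is seen to be
    -- isomorphic to `Pres m R`, which presents `θ`; then let it move to level `γ`. If it never
    -- moved, the assigned algebra would be isomorphic to `θ` and presented by one of its stages, so
    -- the move takes place. Afterwards the algebra is still a quotient of the recognised stage,
    -- hence of `θ`, and it is not isomorphic to `θ` because the levels differ.
    quotient : ∀ ℓ {m} {θ : Rel (suc m)} {γ} → Model θ → θ Realizes ℓ → Below λ′ γ → γ <ℓ ℓ →
      ¬ ¬ (Σ (Rel (suc m)) λ θ′ → Model θ′ × θ ⊑ θ′ × ¬ Iso θ θ′ × θ′ Realizes (just γ))
    quotient ℓ {m} {θ} {γ} M (realizes i lvl iso) c lt κ = finitely-presented ac M λ (R , up , down) →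
      go R up down (Decide.waiting p d m (encodeList R) (codes ℓ) (codes (just γ)))
      where
      go : ∀ R → θ ⊑ Pres m R → Pres m R ⊑ θ → (Σ ℕ λ e → Waiting (codes ℓ) (codes (just γ)) (Answered p d m (encodeList R)) e) → ⊥
      go R up down (e , wt) = waits fired
        where
        open Waiting wt
        Fired : Set
        Fired = Answered p d m (encodeList R) e
        z : ℕ
        z = H e
        S : ℕ → List ℕ
        S u = stage (I z) u u
        S⊑ : ∀ u → Pres (K z) (S u) ⊑ Alg z
        S⊑ u = gen-mono (coded-mono (stage-W (I z) u u))
        Alg≅R : ¬ Fired → Iso (Alg z) (Pres m R)
        Alg≅R h = iso-trans {A = Alg z} {B = Alg (H i)} {C = Pres m R} gen-model gen-model
                    (emin⇒iso {e} {i} (same-level ℓ {e} {i} (level-codes ℓ {e} {i} lvl (unfired h) now) lvl))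
                    (iso-trans {A = Alg (H i)} {B = θ} {C = Pres m R} gen-model gen-model iso (iso-equal M gen-model up down))
        waits : ¬ ¬ Fired
        waits h = finite-subpresentation ac (K z) (W (I z)) λ (R₀ , R₀-W , full) →
          let (u , cover) = stage-covers (I z) R₀ R₀-W in
          h (z , u , H-out e , decides (K z) m (S u) R (iso-trans {A = Pres (K z) (S u)} {B = Alg z} {C = Pres m R} gen-model gen-model
            (iso-equal gen-model gen-model (S⊑ u) (λ q → gen-mono (coded-mono (cover _)) (full q))) (Alg≅R h)))
        quot : ∀ u → Fired → Iso (Pres (K z) (S u)) (Pres m R) → ⊥
        quot u f (φ , ψ , rφ , rψ , hφ , hψ , ψφ , φψ) =
          -- The quotient of the stage is carried over to the generators of `θ` along the
          -- isomorphism `ψ`.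
          κ (pull ψ (Alg z) , pull-model ψ gen-model hψ′ , (λ q → S⊑ u (rψ _ _ (up q))) ,
              (λ θ≅ → levels-differ {λ′} ℓ {γ} {i} {e} lt lvl lvl-γ (iso⇒emin {i} {e}
                 (iso-trans {A = Alg (H i)} {B = θ} {C = Alg z} gen-model gen-model iso
                   (iso-trans {A = θ} {B = pull ψ (Alg z)} {C = Alg z} M gen-model θ≅ pulled)))) ,
              realizes e lvl-γ (iso-sym pulled))
          where
          hψ′ : Hom 𝒱 ψ (Alg z)
          hψ′ f ts = S⊑ u (hψ f ts)
          pulled : Iso (pull ψ (Alg z)) (Alg z)
          pulled = pull-iso ψ φ gen-model hψ′ (λ t → S⊑ u (ψφ t))
          forget : ∀ {x} → x ∈ codes ℓ ⊎ (x ∈ codes (just γ) × Fired) → x ∈ codes ℓ ⊎ x ∈ codes (just γ)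
          forget (inj₁ a) = inj₁ a
          forget (inj₂ (b , _)) = inj₂ b
          lvl-γ : AtLevel λ′ (just γ) e
          lvl-γ = level-drop ℓ {γ} {e} {i} lvl c lt (λ w → forget (sound w)) (later f (here refl))
        fired : ¬ Fired
        fired f@(z′ , u , o , o′) = quot u f (decided (K z) m (S u) R
          (subst (λ z → Out d (query (K z) (encodeList (stage (I z) u u)) m (encodeList R)) 0) (out-unique p e o (H-out e)) o′))

  -- The infinite descent

  module Descent (dfp : DecFP 𝒱) (λ′ : OrdLe) (red : Emin λ′ ≤c VfgIso 𝒱)
                 (k : ℕ) (α : OrdLe) (α≤λ : α ≤O λ′) (red′ : VnIso 𝒱 (suc k) ≤c Emin α) where
    open Reduction dfp λ′ red hiding (emin⇒iso; iso⇒emin)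
    open Levels k α red′

    -- One congruence carries two levels: `ℓ` from the reduction of `Emin λ′`, and a smaller `γ`
    -- from the reduction to `Emin α`. As `α` is at most `λ′`, the ordinal `γ` is also a level for
    -- the former, and passing to the corresponding quotient replaces the pair (ℓ, γ) by (γ, δ) with
    -- δ < γ.
    descend : ∀ {γ} → Acc _≺_ γ → ∀ ℓ {θ : Rel (suc k)} → Model θ → θ Realizes ℓ → θ HasLevel (just γ) → γ <ℓ ℓ → Below α γ → ⊥
    descend {γ} (acc rs) ℓ M real lvl lt b = quotient ℓ M real (below-≤O α≤λ b) lt λ (θ′ , M′ , sub , ¬iso , real′) →
      smaller (just γ) M M′ sub ¬iso lvl λ (δ , c , lt′ , lvl′) →
      descend (rs (proj₁ c , lt′)) (just γ) M′ real′ lvl′ lt′ c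

theorem4p14 : (𝒱 : Variety) → ACC 𝒱 → DecFP 𝒱 →
    (α : ℕ → OrdLe) → (∀ n → omega ≤O α (suc n)) →
    (∀ n → VnIso 𝒱 (suc n) ≤c Emin (α (suc n))) →
    (λ′ : OrdLe) → IsSup α λ′ →
    ¬ (Emin λ′ ≤c VfgIso 𝒱)
-- The doubled algebra of level ⊤ properly contains the free congruence, so `smaller` provides the
-- ordinal `γ` at which the descent starts.
theorem4p14 𝒱 ac dfp α ω≤α red λ′ (ub , _) redλ = has-level {Free N} gen-model λ (ℓ , lvl) →
    smaller ℓ gen-model (doubled-model gen-model) (free-least (doubled-model gen-model)) F≇A lvl λ (γ , b , _ , lvl′) →
    descend (≺-wellFounded γ (proj₁ b)) nothing (doubled-model gen-model)
      (realizes e∅ (proj₂ emptyIndex) (iso-sym (doubled-iso gen-model))) lvl′ tt b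
  where
  open Main 𝒱 ac
  open Algebra 𝒱
  open Reduction dfp λ′ redλ
  e∅ = proj₁ emptyIndex
  k = K (H e∅)
  N = suc (suc k)
  open Descent dfp λ′ redλ (suc k) (α N) (ub (suc k)) (red (suc k))
  open Levels (suc k) (α N) (red (suc k)) hiding (emin⇒iso; iso⇒emin)
  A : Rel (suc k)
  A = Alg (H e∅)
  zero-below-λ : Below λ′ []
  zero-below-λ = below-≤O (ub 0) (zero-below (ω≤α 0))
  F≇A : ¬ Iso (Free N) (doubled A)
  -- If the first two free generators coincide, all algebras of the variety are trivial and `redλ`
  -- would identify the empty set with the singleton of the code of the ordinal 0.
  F≇A iso = free≇doubled ac gen-model iso λ x₀≡x₁ →
    let (e , snd′ , cpl) = finite-index (hα λ′ [] ∷ [])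
    in levels-differ {λ′} nothing {[]} {e∅} {e} tt (proj₂ emptyIndex)
         (zero-below-λ , cpl (here refl) , λ { y w → least y (snd′ w) })
         (iso⇒emin {e∅} {e} (total-iso (trivial x₀≡x₁ gen-model) (trivial x₀≡x₁ gen-model)))
    where
    least : ∀ y → y ∈ hα λ′ [] ∷ [] → hα λ′ [] ≤[ λ′ ] y
    least y (here refl) = ⇒code≤ {λ′} zero-below-λ zero-below-λ (inj₂ refl)
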